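{- Let $B_6=\left(\frac{ -1,3}{\mathbb Q}\right)$ with $i^2=-1$, $j^2=3$, $ij=-ji$, and let $\mathcal O(6,1)=\mathbb Z+\mathbb Zi+\mathbb Zj+\mathbb Z\frac{1+i+j+ij}{2}$ (a maximal order). Then: (a) Among the index-$3$ sublattices of $\mathcal O(6,1)$ that are subrings (orders), exactly one has reduced discriminant $18$; call it $\mathcal O(6,3)$. It is stable under $\zeta_3=\tfrac12(-1+3i+j+ij)$ (i.e. under conjugation by $\zeta_3$). (b) Put $\mathcal O'(6,N)=\{\alpha\in\mathcal O(6,N):\operatorname{trd}(\alpha)\in2\mathbb Z\}$ for $N=1,3$. These are orders, of reduced discriminants $12$ and $36$ respectively. (c) For each of the four orders $\mathcal O$ in the list $\mathcal O(6,1),\ \mathcal O(6,3),\ \mathcal O'(6,1),\ \mathcal O'(6,3)$, with reduced discriminant $d(\mathcal O)=6,18,12,36$, the lattice of trace-zero elements of the dual lattice $\mathcal O^\sharp$, with the reduced-norm form scaled by $s=-d(\mathcal O)$, is an even ternary lattice in the genus of, respectively, $G_1,\ G_2,\ G_3,\ G_4$. Thus $$G_1\leftrightarrow\mathcal O(6,1),\quad G_2\leftrightarrow\mathcal O(6,3),\quad G_3\leftrightarrow\mathcal O'(6,1),\quad G_4\leftrightarrow\mathcal O'(6,3).$$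
   Context: $\operatorname{trd}$, $\operatorname{nrd}$ are the reduced trace and norm of $B_6$, and $\bar x$ is the standard involution. $\mathcal O^\sharp=\{x\in B_6:\operatorname{trd}(x\mathcal O)\subset\mathbb Z\}$. The scaled form on $(\mathcal O^\sharp)_0=\{x\in\mathcal O^\sharp:\operatorname{trd}x=0\}$ is the quadratic form $Q(x)=s\operatorname{nrd}(x)$, with Gram matrix $s\operatorname{trd}(x\bar y)$. The matrices $G_i$ are Gram matrices of even lattices $\mathbb Z^3$ of signature $(2,1)$: $$G_1=\begin{pmatrix}6&0&-3\\0&4&-2\\-3&-2&2\end{pmatrix},\ G_2=\begin{pmatrix}2&0&-3\\0&12&-6\\-3&-6&6\end{pmatrix},\ G_3=\begin{pmatrix}12&0&-6\\0&2&-2\\-6&-2&4\end{pmatrix},\ G_4=\begin{pmatrix}4&0&-6\\0&6&-6\\-6&-6&12\end{pmatrix}.$$ -}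

module Defs where

open import Level using (Level; 0ℓ)
open import Algebra.Bundles.Raw using (RawRing; RawMonoid)
import Algebra.Definitions.RawMonoid as RawMonoidOps
open import Data.Nat.Base as ℕ using (ℕ; zero; suc)
open import Data.Nat.Primality using (Prime)
open import Data.Integer.Base as ℤ using (ℤ; +_; -[1+_])
import Data.Integer.Properties as ℤ
open import Data.Integer.Divisibility.Signed
  using (_∣_; ∣m⇒∣m*n; ∣n⇒∣m*n; ∣m∣n⇒∣m+n; ∣m⇒∣-m; divides)
open import Data.Integer.Solver using () renaming (module +-*-Solver to ℤ-Solver)
open import Data.Rational.Base as ℚ using (ℚ; 0ℚ; 1ℚ; ½; -½; _/_)
import Data.Rational.Properties as ℚ
open import Data.Rational.Solver using () renaming (module +-*-Solver to ℚ-Solver)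
open import Data.Fin.Base using (Fin; zero; suc; punchIn)
import Data.Fin.Properties as Fin
open import Data.List.Base using (length; filter; allFin)
open import Data.Vec.Functional as Vector using (Vector; []; _∷_)
open import Data.Product.Base using (Σ-syntax; ∃-syntax; _×_)
open import Data.Product using (∃!)
open import Function.Bundles using (_⇔_)
open import Relation.Binary.PropositionalEquality
  using (_≡_; _≢_; refl; subst)
open import Relation.Nullary.Decidable using (yes; no)
open import Relation.Unary using (Pred; _∈_; _⊆_; _≐_)

module Matrices {c ℓ : Level} (R : RawRing c ℓ) where
  open RawRing R
  open RawMonoidOps +-rawMonoid using (sum)

  Matrix : ℕ → Set c
  Matrix n = Fin n → Fin n → Carrier

  _≋_ : ∀ {n} → Matrix n → Matrix n → Set ℓ
  A ≋ B = ∀ i j → A i j ≈ B i j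

  _⊗_ : ∀ {n} → Matrix n → Matrix n → Matrix n
  (A ⊗ B) i j = sum λ k → A i k * B k j

  _ᵀ : ∀ {n} → Matrix n → Matrix n
  (A ᵀ) i j = A j i

  Id : ∀ {n} → Matrix n
  Id i j with i Fin.≟ j
  ... | yes _ = 1#
  ... | no  _ = 0#

  -- Laplace expansion along the first row; the foldr produces the
  -- alternating signs  x₀ - (x₁ - (x₂ - …)).
  det : ∀ {n} → Matrix n → Carrier
  det {zero}  A = 1#
  det {suc n} A = Vector.foldr (λ x acc → x + (- acc)) 0#
    λ j → A zero j * det (λ i k → A (suc i) (punchIn j k))

  Invertible : ∀ {n} → Matrix n → Set _
  Invertible T = ∃[ S ] (T ⊗ S) ≋ Id × (S ⊗ T) ≋ Id

  -- Isometry of the free modules Rⁿ with Gram matrices A and B.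
  Isometric : ∀ {n} → Matrix n → Matrix n → Set _
  Isometric A B = ∃[ T ] Invertible T × (((T ᵀ) ⊗ A) ⊗ T) ≋ B

-- The p-adic integers as the inverse limit of ℤ/pⁿ: the n-th term of a
-- sequence is significant only modulo pⁿ, so equality is _≈ₚ_, not _≡_.

record ℤₚ (p : ℕ) : Set where
  field
    approx   : ℕ → ℤ
    coherent : ∀ n → + (p ℕ.^ n) ∣ approx (suc n) ℤ.- approx n

open ℤₚ

_≈ₚ_ : ∀ {p} → ℤₚ p → ℤₚ p → Set
_≈ₚ_ {p} x y = ∀ n → + (p ℕ.^ n) ∣ approx x n ℤ.- approx y n

constₚ : ∀ {p} → ℤ → ℤₚ p
constₚ z .approx _ = z
constₚ z .coherent n = divides (+ 0) (ℤ.+-inverseʳ z)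

_+ₚ_ : ∀ {p} → ℤₚ p → ℤₚ p → ℤₚ p
(x +ₚ y) .approx n = approx x n ℤ.+ approx y n
_+ₚ_ {p} x y .coherent n =
  subst (+ (p ℕ.^ n) ∣_)
    (solve 4 (λ a b c d → (a :- b) :+ (c :- d) := (a :+ c) :- (b :+ d)) refl
      (approx x (suc n)) (approx x n) (approx y (suc n)) (approx y n))
    (∣m∣n⇒∣m+n (coherent x n) (coherent y n))
  where open ℤ-Solver

-ₚ_ : ∀ {p} → ℤₚ p → ℤₚ p
(-ₚ x) .approx n = ℤ.- approx x n
-ₚ_ {p} x .coherent n =
  subst (+ (p ℕ.^ n) ∣_)
    (solve 2 (λ a b → :- (a :- b) := (:- a) :- (:- b)) refl
      (approx x (suc n)) (approx x n))
    (∣m⇒∣-m (coherent x n))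
  where open ℤ-Solver

_*ₚ_ : ∀ {p} → ℤₚ p → ℤₚ p → ℤₚ p
(x *ₚ y) .approx n = approx x n ℤ.* approx y n
_*ₚ_ {p} x y .coherent n =
  subst (+ (p ℕ.^ n) ∣_)
    (solve 4 (λ a b c d → (a :- b) :* c :+ b :* (c :- d) := a :* c :- b :* d) refl
      (approx x (suc n)) (approx x n) (approx y (suc n)) (approx y n))
    (∣m∣n⇒∣m+n (∣m⇒∣m*n (approx y (suc n)) (coherent x n))
               (∣n⇒∣m*n (approx x n) (coherent y n)))
  where open ℤ-Solver

ℤₚ-rawRing : ℕ → RawRing 0ℓ 0ℓ
ℤₚ-rawRing p = record
  { Carrier = ℤₚ p
  ; _≈_     = _≈ₚ_
  ; _+_     = _+ₚ_
  ; _*_     = _*ₚ_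
  ; -_      = -ₚ_
  ; 0#      = constₚ (+ 0)
  ; 1#      = constₚ (+ 1)
  }

module Matℤ       = Matrices ℤ.+-*-rawRing
module Matℚ       = Matrices ℚ.+-*-rawRing
module Matℤₚ (p : ℕ) = Matrices (ℤₚ-rawRing p)

toℚ : ℤ → ℚ
toℚ z = z / 1

-- Signature by diagonalisation over ℚ; by Sylvester's law of inertia this
-- is the signature of the real quadratic space.
HasSignature : ∀ {n} → Matℤ.Matrix n → ℕ → ℕ → Set
HasSignature {n} A r s = ∃[ D ]
    Matℚ.Isometric (λ i j → toℚ (A i j)) D
  × (∀ i j → i ≢ j → D i j ≡ 0ℚ)
  × length (filter (λ i → 0ℚ ℚ.<? D i i) (allFin n)) ≡ r
  × length (filter (λ i → D i i ℚ.<? 0ℚ) (allFin n)) ≡ s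

SameGenus : ∀ {n} → Matℤ.Matrix n → Matℤ.Matrix n → Set
SameGenus A B =
    (∃[ r ] ∃[ s ] HasSignature A r s × HasSignature B r s)
  × (∀ p → Prime p →
       Matℤₚ.Isometric p (λ i j → constₚ (A i j)) (λ i j → constₚ (B i j)))

-- quat t x y z  is  t + x i + y j + z ij  in the algebra (a,b / ℚ), where
-- i² = a, j² = b, ij = -ji.
record Quaternion (a b : ℚ) : Set where
  constructor quat
  field
    re im-i im-j im-ij : ℚ

open Quaternion

module _ {a b : ℚ} where
  infixl 6 _+ᴮ_ _-ᴮ_
  infixl 7 _*ᴮ_ _·_

  scalar : ℚ → Quaternion a b
  scalar q = quat q 0ℚ 0ℚ 0ℚ

  0ᴮ 1ᴮ : Quaternion a b
  0ᴮ = scalar 0ℚ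
  1ᴮ = scalar 1ℚ

  _+ᴮ_ _-ᴮ_ _*ᴮ_ : Quaternion a b → Quaternion a b → Quaternion a b
  quat t x y z +ᴮ quat t′ x′ y′ z′ =
    quat (t ℚ.+ t′) (x ℚ.+ x′) (y ℚ.+ y′) (z ℚ.+ z′)
  quat t x y z -ᴮ quat t′ x′ y′ z′ =
    quat (t ℚ.- t′) (x ℚ.- x′) (y ℚ.- y′) (z ℚ.- z′)
  quat t x y z *ᴮ quat t′ x′ y′ z′ = quat
    (t ℚ.* t′ ℚ.+ a ℚ.* (x ℚ.* x′) ℚ.+ b ℚ.* (y ℚ.* y′)
       ℚ.- a ℚ.* b ℚ.* (z ℚ.* z′))
    (t ℚ.* x′ ℚ.+ x ℚ.* t′ ℚ.- b ℚ.* (y ℚ.* z′) ℚ.+ b ℚ.* (z ℚ.* y′))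
    (t ℚ.* y′ ℚ.+ y ℚ.* t′ ℚ.+ a ℚ.* (x ℚ.* z′) ℚ.- a ℚ.* (z ℚ.* x′))
    (t ℚ.* z′ ℚ.+ z ℚ.* t′ ℚ.+ x ℚ.* y′ ℚ.- y ℚ.* x′)

  _·_ : ℚ → Quaternion a b → Quaternion a b
  q · quat t x y z = quat (q ℚ.* t) (q ℚ.* x) (q ℚ.* y) (q ℚ.* z)

  conj : Quaternion a b → Quaternion a b
  conj (quat t x y z) = quat t (ℚ.- x) (ℚ.- y) (ℚ.- z)

  -- x + x̄ and x x̄ are scalars, so they are recorded by their real parts.
  trd nrd : Quaternion a b → ℚ
  trd x = re (x +ᴮ conj x)
  nrd x = re (x *ᴮ conj x)

  +ᴮ-rawMonoid : RawMonoid 0ℓ 0ℓ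
  +ᴮ-rawMonoid = record
    { Carrier = Quaternion a b ; _≈_ = _≡_ ; _∙_ = _+ᴮ_ ; ε = 0ᴮ }

  open RawMonoidOps +ᴮ-rawMonoid using () renaming (sum to sumᴮ)

  combination : ∀ {n} → Vector ℤ n → Vector (Quaternion a b) n → Quaternion a b
  combination c e = sumᴮ λ k → toℚ (c k) · e k

B₆ : Set
B₆ = Quaternion (ℚ.- 1ℚ) (+ 3 / 1)

Subset : Set₁
Subset = Pred B₆ 0ℓ

span : ∀ {n} → Vector B₆ n → Subset
span e x = ∃[ c ] x ≡ combination c e

record IsBasis {n : ℕ} (L : Subset) (e : Vector B₆ n) : Set where
  field
    spanning    : L ≐ span e
    independent : ∀ c → combination c e ≡ 0ᴮ → ∀ k → c k ≡ + 0

record IsOrder (O : Subset) : Set where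
  field
    lattice  : Σ[ e ∈ Vector B₆ 4 ] IsBasis O e
    one      : 1ᴮ ∈ O
    *-closed : ∀ {x y} → x ∈ O → y ∈ O → x *ᴮ y ∈ O

IsMaximalOrder : Subset → Set₁
IsMaximalOrder O = IsOrder O × (∀ O′ → IsOrder O′ → O ⊆ O′ → O′ ⊆ O)

-- [M : L] = n, through a complete irredundant system of coset
-- representatives.
HasIndex : ℕ → Subset → Subset → Set
HasIndex n L M = Σ[ r ∈ Vector B₆ n ]
    (∀ k → r k ∈ M)
  × (∀ x → x ∈ M → ∃! _≡_ λ k → x -ᴮ r k ∈ L)

-- The reduced discriminant d is the positive square root of the
-- discriminant |det (trd (eᵢ eⱼ))|.
HasReducedDiscriminant : Subset → ℕ → Set
HasReducedDiscriminant O d = Σ[ e ∈ Vector B₆ 4 ]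
    IsBasis O e
  × toℚ (+ (d ℕ.* d)) ≡ ℚ.∣ Matℚ.det (λ i j → trd (e i *ᴮ e j)) ∣

-- u is a unit of B₆ with  u L u⁻¹ = L.
StableUnderConjugation : B₆ → Subset → Set
StableUnderConjugation u L = Σ[ v ∈ B₆ ]
    u *ᴮ v ≡ 1ᴮ
  × v *ᴮ u ≡ 1ᴮ
  × (∀ x → x ∈ L ⇔ (u *ᴮ x) *ᴮ v ∈ L)

_♯ : Subset → Subset
(O ♯) x = ∀ y → y ∈ O → ∃[ z ] trd (x *ᴮ y) ≡ toℚ z

_₀ : Subset → Subset
(L ₀) x = x ∈ L × trd x ≡ 0ℚ

evenTrace : Subset → Subset
evenTrace O x = x ∈ O × ∃[ z ] trd x ≡ toℚ (+ 2 ℤ.* z)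

scaledNorm : ℚ → B₆ → ℚ
scaledNorm s x = s ℚ.* nrd x

bilinear : ℚ → B₆ → B₆ → ℚ
bilinear s x y = s ℚ.* trd (x *ᴮ conj y)

bilinear-polar : ∀ s x y →
  scaledNorm s (x +ᴮ y) ≡ scaledNorm s x ℚ.+ scaledNorm s y ℚ.+ bilinear s x y
bilinear-polar s (quat t x y z) (quat t′ x′ y′ z′) =
  solve 11
    (λ s a b t x y z t′ x′ y′ z′ →
      let r = λ t x y z t′ x′ y′ z′ →
                t :* t′ :+ a :* (x :* x′) :+ b :* (y :* y′)
                  :- a :* b :* (z :* z′)
          n = λ t x y z → s :* r t x y z t (:- x) (:- y) (:- z)
          m = r t x y z t′ (:- x′) (:- y′) (:- z′)
      in n (t :+ t′) (x :+ x′) (y :+ y′) (z :+ z′)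
           := n t x y z :+ n t′ x′ y′ z′ :+ s :* (m :+ m))
    refl s (ℚ.- 1ℚ) (+ 3 / 1) t x y z t′ x′ y′ z′
  where open ℚ-Solver

-- L with the form scaledNorm s is an even lattice of rank n in the genus
-- of the lattice ℤⁿ with Gram matrix G.
record IsEvenLatticeInGenus {n : ℕ} (s : ℚ) (L : Subset) (G : Matℤ.Matrix n) : Set where
  field
    basis    : Vector B₆ n
    isBasis  : IsBasis L basis
    gram     : Matℤ.Matrix n
    gram-eq  : ∀ i j → bilinear s (basis i) (basis j) ≡ toℚ (gram i j)
    even     : ∀ i → + 2 ∣ gram i i
    inGenus  : SameGenus gram G

-- O has reduced discriminant d, and (O♯)₀ scaled by -d lies in the genus of G.
CorrespondsTo : Subset → ℕ → Matℤ.Matrix 3 → Set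
CorrespondsTo O d G =
    HasReducedDiscriminant O d
  × IsEvenLatticeInGenus (ℚ.- toℚ (+ d)) ((O ♯) ₀) G

𝒪⟨6,1⟩ : Subset
𝒪⟨6,1⟩ = span
  ( 1ᴮ
  ∷ quat 0ℚ 1ℚ 0ℚ 0ℚ
  ∷ quat 0ℚ 0ℚ 1ℚ 0ℚ
  ∷ quat ½ ½ ½ ½
  ∷ [])

ζ₃ : B₆
ζ₃ = quat -½ (+ 3 / 2) ½ ½

G₁ G₂ G₃ G₄ : Matℤ.Matrix 3
G₁ = (  + 6     ∷   + 0     ∷ -[1+ 2 ] ∷ [])
   ∷ (  + 0     ∷   + 4     ∷ -[1+ 1 ] ∷ [])
   ∷ (-[1+ 2 ]  ∷ -[1+ 1 ]  ∷   + 2    ∷ [])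
   ∷ []
G₂ = (  + 2     ∷   + 0     ∷ -[1+ 2 ] ∷ [])
   ∷ (  + 0     ∷   + 12    ∷ -[1+ 5 ] ∷ [])
   ∷ (-[1+ 2 ]  ∷ -[1+ 5 ]  ∷   + 6    ∷ [])
   ∷ []
G₃ = (  + 12    ∷   + 0     ∷ -[1+ 5 ] ∷ [])
   ∷ (  + 0     ∷   + 2     ∷ -[1+ 1 ] ∷ [])
   ∷ (-[1+ 5 ]  ∷ -[1+ 1 ]  ∷   + 4    ∷ [])
   ∷ []
G₄ = (  + 4     ∷   + 0     ∷ -[1+ 5 ] ∷ [])
   ∷ (  + 0     ∷   + 6     ∷ -[1+ 5 ] ∷ [])
   ∷ (-[1+ 5 ]  ∷ -[1+ 5 ]  ∷   + 12   ∷ [])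
   ∷ []

{-# OPTIONS --safe #-}

-- (c) Each of the four orders has a basis fₙ starting with 1, so the last three
-- vectors of the trace-dual basis eₙ span the trace-zero part of the dual lattice.
-- These bases are chosen so that the Gram matrix is Gₙ itself, and the genus
-- condition holds through the identity.  The even-trace suborder of an order O
-- is obtained in the same way, being the dual of O♯ + ½ℤ.
--
-- Maximality: if x lies in an order, then all powers of x lie in one lattice, so the
-- powers of nrd x have a common denominator and nrd x ∈ ℤ; hence also
-- trd x = nrd (1 + x) - nrd x - 1 ∈ ℤ.  If the order contains 𝒪⟨6,1⟩, then the traces
-- α, β, γ, δ of x, xi, xj, xij are integers with 3(α² + β²) - (γ² + δ²) = 12 nrd x, and
-- this equation modulo 3 and modulo 4 already forces x ∈ 𝒪⟨6,1⟩.
--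
-- Uniqueness in (a): a suborder L of index 3 contains 3𝒪⟨6,1⟩, and of any two elements
-- y, z of 𝒪⟨6,1⟩ either y ∈ L or z + εy ∈ L for some ε ∈ {0, 1, -1}.  Multiplying
-- i + εj by ij + δj shows j ∈ L, and then multiplying i + εij by j shows ij ∈ L.
-- Together with 1 and 3𝒪⟨6,1⟩ these generate 𝒪⟨6,3⟩, and comparing indices L = 𝒪⟨6,3⟩.

module Submission where

open import Defs
import Algebra.Definitions.RawMonoid as RawMonoidOps
open import Data.Empty using (⊥-elim)
open import Data.Fin.Base as Fin using (Fin; zero; suc; toℕ; fromℕ<; _↑ʳ_)
open import Data.Fin.Patterns
import Data.Fin.Properties as Fin
open import Data.Integer.Base as ℤ using (ℤ; +_; -[1+_])
open import Data.Integer.Coprimality using (coprime-divisor)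
open import Data.Integer.DivMod using (a≡a%ℕn+[a/ℕn]*n; n%ℕd<d)
open import Data.Integer.Divisibility.Signed
  using (_∣_; _∣?_; divides; ∣ᵤ⇒∣; ∣⇒∣ᵤ; ∣m∣n⇒∣m+n; ∣m+n∣n⇒∣m; ∣m⇒∣m*n)
import Data.Integer.Properties as ℤ
open import Data.Integer.Solver using () renaming (module +-*-Solver to ℤ-Solver)
open import Data.List.Base using (length; filter; allFin)
open import Data.Nat.Base as ℕ using (ℕ; zero; suc)
open import Data.Nat.Coprimality as Coprime using (Coprime)
import Data.Nat.Properties as ℕ
open import Data.Product using (_×_; Σ-syntax; ∃-syntax; _,_; proj₁; proj₂)
open import Data.Rational.Base as ℚ using (ℚ; mkℚ; 0ℚ; 1ℚ; ½; -½; _/_; ↥_; ↧_)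
import Data.Rational.Properties as ℚ
open import Data.Rational.Solver using () renaming (module +-*-Solver to ℚ-Solver)
open import Data.Rational.Unnormalised.Base as ℚᵘ using (mkℚᵘ; *≡*)
import Data.Rational.Unnormalised.Properties as ℚᵘ
open import Data.Sum.Base using (_⊎_; inj₁; inj₂)
open import Data.Vec.Base using (Vec)
open import Data.Vec.Functional as Vector using (Vector)
open import Function.Base using (_∘_; id)
open import Function.Bundles using (mk⇔)
open import Relation.Binary.PropositionalEquality
  using (_≡_; _≢_; refl; sym; trans; cong; cong₂; subst; module ≡-Reasoning)
open import Relation.Nullary.Decidable
  using (Dec; yes; no; map′; True; toWitness; from-yes; _×-dec_; _→-dec_)
open import Relation.Nullary.Negation using (¬_)
open import Relation.Unary using (_⊆_; _≐_; _∈_)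

open Quaternion

-- Integers among the rationals

-- `z / 1` is normalised through a gcd and does not compute for a variable `z`. Its unnormalised
-- counterpart `mkℚᵘ z 0` does, so the homomorphism laws below are proved there and carried back.
toℚᵘ-toℚ : ∀ z → ℚ.toℚᵘ (toℚ z) ℚᵘ.≃ mkℚᵘ z 0
toℚᵘ-toℚ z = ℚ.toℚᵘ-fromℚᵘ (mkℚᵘ z 0)

toℚ-+ : ∀ y z → toℚ (y ℤ.+ z) ≡ toℚ y ℚ.+ toℚ z
toℚ-+ y z = ℚ.toℚᵘ-injective (begin
  ℚ.toℚᵘ (toℚ (y ℤ.+ z))                ≈⟨ toℚᵘ-toℚ (y ℤ.+ z) ⟩
  mkℚᵘ (y ℤ.+ z) 0                      ≡⟨ cong₂ (λ u v → mkℚᵘ (u ℤ.+ v) 0) (ℤ.*-identityʳ y) (ℤ.*-identityʳ z) ⟨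
  mkℚᵘ y 0 ℚᵘ.+ mkℚᵘ z 0                ≈⟨ ℚᵘ.+-cong (toℚᵘ-toℚ y) (toℚᵘ-toℚ z) ⟨
  ℚ.toℚᵘ (toℚ y) ℚᵘ.+ ℚ.toℚᵘ (toℚ z)    ≈⟨ ℚ.toℚᵘ-homo-+ (toℚ y) (toℚ z) ⟨
  ℚ.toℚᵘ (toℚ y ℚ.+ toℚ z)              ∎)
  where open ℚᵘ.≃-Reasoning

toℚ-* : ∀ y z → toℚ (y ℤ.* z) ≡ toℚ y ℚ.* toℚ z
toℚ-* y z = ℚ.toℚᵘ-injective (begin
  ℚ.toℚᵘ (toℚ (y ℤ.* z))                ≈⟨ toℚᵘ-toℚ (y ℤ.* z) ⟩
  mkℚᵘ y 0 ℚᵘ.* mkℚᵘ z 0                ≈⟨ ℚᵘ.*-cong (toℚᵘ-toℚ y) (toℚᵘ-toℚ z) ⟨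
  ℚ.toℚᵘ (toℚ y) ℚᵘ.* ℚ.toℚᵘ (toℚ z)    ≈⟨ ℚ.toℚᵘ-homo-* (toℚ y) (toℚ z) ⟨
  ℚ.toℚᵘ (toℚ y ℚ.* toℚ z)              ∎)
  where open ℚᵘ.≃-Reasoning

toℚ-injective : ∀ {y z} → toℚ y ≡ toℚ z → y ≡ z
toℚ-injective {y} {z} eq with ℚ.fromℚᵘ-injective {mkℚᵘ y 0} {mkℚᵘ z 0} eq
... | *≡* y*1≡z*1 = trans (sym (ℤ.*-identityʳ y)) (trans y*1≡z*1 (ℤ.*-identityʳ z))

Integer : ℚ → Set
Integer q = ∃[ z ] q ≡ toℚ z

integer-+ : ∀ {p q} → Integer p → Integer q → Integer (p ℚ.+ q)
integer-+ (y , refl) (z , refl) = y ℤ.+ z , sym (toℚ-+ y z)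

integer-* : ∀ {p q} → Integer p → Integer q → Integer (p ℚ.* q)
integer-* (y , refl) (z , refl) = y ℤ.* z , sym (toℚ-* y z)

-- Quaternion arithmetic

module _ {a b : ℚ} where
  private variable x y : Quaternion a b

  quat-≡ : re x ≡ re y → im-i x ≡ im-i y → im-j x ≡ im-j y → im-ij x ≡ im-ij y → x ≡ y
  quat-≡ refl refl refl refl = refl

  _≟ᴮ_ : (x y : Quaternion a b) → Dec (x ≡ y)
  x ≟ᴮ y = map′ (λ (p , q , r , s) → quat-≡ p q r s)
    (λ { refl → refl , refl , refl , refl })
    (re x ℚ.≟ re y ×-dec im-i x ℚ.≟ im-i y ×-dec im-j x ℚ.≟ im-j y ×-dec im-ij x ℚ.≟ im-ij y)

-- Quaternions with polynomial coordinates, so that identities between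
-- quaternion expressions are decided by the ring solver, coordinatewise.
module Symbolic {n : ℕ} where
  open ℚ-Solver

  record Poly : Set where
    constructor quatᴾ
    field
      reᴾ iᴾ jᴾ ijᴾ : Polynomial n

  open Poly public

  _+ᴾ_ : Poly → Poly → Poly
  quatᴾ t x y z +ᴾ quatᴾ t′ x′ y′ z′ = quatᴾ (t :+ t′) (x :+ x′) (y :+ y′) (z :+ z′)

  _-ᴾ_ : Poly → Poly → Poly
  quatᴾ t x y z -ᴾ quatᴾ t′ x′ y′ z′ = quatᴾ (t :- t′) (x :- x′) (y :- y′) (z :- z′)

  mulᴾ : (a b : Polynomial n) → Poly → Poly → Poly
  mulᴾ a b (quatᴾ t x y z) (quatᴾ t′ x′ y′ z′) = quatᴾ
    (t :* t′ :+ a :* (x :* x′) :+ b :* (y :* y′) :- a :* b :* (z :* z′))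
    (t :* x′ :+ x :* t′ :- b :* (y :* z′) :+ b :* (z :* y′))
    (t :* y′ :+ y :* t′ :+ a :* (x :* z′) :- a :* (z :* x′))
    (t :* z′ :+ z :* t′ :+ x :* y′ :- y :* x′)

  _·ᴾ_ : Polynomial n → Poly → Poly
  q ·ᴾ quatᴾ t x y z = quatᴾ (q :* t) (q :* x) (q :* y) (q :* z)

  conjᴾ : Poly → Poly
  conjᴾ (quatᴾ t x y z) = quatᴾ t (:- x) (:- y) (:- z)

  trdᴾ : Poly → Polynomial n
  trdᴾ x = reᴾ (x +ᴾ conjᴾ x)

  nrdᴾ : (a b : Polynomial n) → Poly → Polynomial n
  nrdᴾ a b x = reᴾ (mulᴾ a b x (conjᴾ x))

  evalᴾ : ∀ {a b} → Vec ℚ n → Poly → Quaternion a b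
  evalᴾ ρ (quatᴾ t x y z) = quat (⟦ t ⟧ ρ) (⟦ x ⟧ ρ) (⟦ y ⟧ ρ) (⟦ z ⟧ ρ)

  prove-quat : ∀ {a b} (ρ : Vec ℚ n) (f g : Poly) →
    ⟦ reᴾ f ⟧↓ ρ ≡ ⟦ reᴾ g ⟧↓ ρ → ⟦ iᴾ f ⟧↓ ρ ≡ ⟦ iᴾ g ⟧↓ ρ →
    ⟦ jᴾ f ⟧↓ ρ ≡ ⟦ jᴾ g ⟧↓ ρ → ⟦ ijᴾ f ⟧↓ ρ ≡ ⟦ ijᴾ g ⟧↓ ρ →
    evalᴾ {a} {b} ρ f ≡ evalᴾ ρ g
  prove-quat ρ f g p q r s = quat-≡
    (prove ρ (reᴾ f) (reᴾ g) p) (prove ρ (iᴾ f) (iᴾ g) q)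
    (prove ρ (jᴾ f) (jᴾ g) r) (prove ρ (ijᴾ f) (ijᴾ g) s)

module Variables where
  open ℚ-Solver
  open Symbolic {16}

  -- One list of sixteen variables serves all the identities: the two structure constants, two
  -- rational scalars and the coordinates of three quaternions, in the order of `env`. Slots that do
  -- not occur in an identity are filled with `0ℚ` or `0ᴮ`.
  𝕒 𝕓 𝕡 𝕢 : Polynomial 16
  𝕒 = var 0F
  𝕓 = var 1F
  𝕡 = var 2F
  𝕢 = var 3F

  𝕩 𝕪 𝕫 : Poly
  𝕩 = quatᴾ (var 4F) (var 5F) (var 6F) (var 7F)
  𝕪 = quatᴾ (var 8F) (var 9F) (var (10 ↑ʳ 0F)) (var (11 ↑ʳ 0F))
  𝕫 = quatᴾ (var (12 ↑ʳ 0F)) (var (13 ↑ʳ 0F)) (var (14 ↑ʳ 0F)) (var (15 ↑ʳ 0F))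

  constᴾ : ℚ → Poly
  constᴾ q = quatᴾ (con q) (con 0ℚ) (con 0ℚ) (con 0ℚ)

module _ {a b : ℚ} where
  open ℚ-Solver
  open Symbolic
  open Variables
  open import Data.Vec.Base using ([]; _∷_)

  env : (p q : ℚ) (x y z : Quaternion a b) → Vec ℚ 16
  env p q (quat t x y z) (quat t′ x′ y′ z′) (quat t″ x″ y″ z″) =
    a ∷ b ∷ p ∷ q ∷ t ∷ x ∷ y ∷ z ∷ t′ ∷ x′ ∷ y′ ∷ z′ ∷ t″ ∷ x″ ∷ y″ ∷ z″ ∷ []

  *ᴮ-distribˡ-+ᴮ : (x y z : Quaternion a b) → x *ᴮ (y +ᴮ z) ≡ x *ᴮ y +ᴮ x *ᴮ z
  *ᴮ-distribˡ-+ᴮ x y z = prove-quat (env 0ℚ 0ℚ x y z)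
    (mulᴾ 𝕒 𝕓 𝕩 (𝕪 +ᴾ 𝕫)) (mulᴾ 𝕒 𝕓 𝕩 𝕪 +ᴾ mulᴾ 𝕒 𝕓 𝕩 𝕫) refl refl refl refl

  *ᴮ-distribʳ-+ᴮ : (x y z : Quaternion a b) → (x +ᴮ y) *ᴮ z ≡ x *ᴮ z +ᴮ y *ᴮ z
  *ᴮ-distribʳ-+ᴮ x y z = prove-quat (env 0ℚ 0ℚ x y z)
    (mulᴾ 𝕒 𝕓 (𝕩 +ᴾ 𝕪) 𝕫) (mulᴾ 𝕒 𝕓 𝕩 𝕫 +ᴾ mulᴾ 𝕒 𝕓 𝕪 𝕫) refl refl refl refl

  ·-*ᴮ-assoc : ∀ q (x y : Quaternion a b) → (q · x) *ᴮ y ≡ q · (x *ᴮ y)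
  ·-*ᴮ-assoc q x y = prove-quat (env 0ℚ q x y 0ᴮ)
    (mulᴾ 𝕒 𝕓 (𝕢 ·ᴾ 𝕩) 𝕪) (𝕢 ·ᴾ mulᴾ 𝕒 𝕓 𝕩 𝕪) refl refl refl refl

  *ᴮ-·-comm : ∀ q (x y : Quaternion a b) → x *ᴮ (q · y) ≡ q · (x *ᴮ y)
  *ᴮ-·-comm q x y = prove-quat (env 0ℚ q x y 0ᴮ)
    (mulᴾ 𝕒 𝕓 𝕩 (𝕢 ·ᴾ 𝕪)) (𝕢 ·ᴾ mulᴾ 𝕒 𝕓 𝕩 𝕪) refl refl refl refl

  trd-+ᴮ : (x y : Quaternion a b) → trd (x +ᴮ y) ≡ trd x ℚ.+ trd y
  trd-+ᴮ x y = prove (env 0ℚ 0ℚ x y 0ᴮ) (trdᴾ (𝕩 +ᴾ 𝕪)) (trdᴾ 𝕩 :+ trdᴾ 𝕪) refl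

  trd-· : ∀ q (x : Quaternion a b) → trd (q · x) ≡ q ℚ.* trd x
  trd-· q x = prove (env 0ℚ q x 0ᴮ 0ᴮ) (trdᴾ (𝕢 ·ᴾ 𝕩)) (𝕢 :* trdᴾ 𝕩) refl

  nrd-*ᴮ : (x y : Quaternion a b) → nrd (x *ᴮ y) ≡ nrd x ℚ.* nrd y
  nrd-*ᴮ x y = prove (env 0ℚ 0ℚ x y 0ᴮ)
    (nrdᴾ 𝕒 𝕓 (mulᴾ 𝕒 𝕓 𝕩 𝕪)) (nrdᴾ 𝕒 𝕓 𝕩 :* nrdᴾ 𝕒 𝕓 𝕪) refl

  nrd-· : ∀ q (x : Quaternion a b) → nrd (q · x) ≡ q ℚ.* q ℚ.* nrd x
  nrd-· q x = prove (env 0ℚ q x 0ᴮ 0ᴮ) (nrdᴾ 𝕒 𝕓 (𝕢 ·ᴾ 𝕩)) (𝕢 :* 𝕢 :* nrdᴾ 𝕒 𝕓 𝕩) refl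

  -- From nrd (1 + x) = 1 + trd x + nrd x. Subtraction is written as multiplication by -1, so that
  -- `integer-+` and `integer-*` carry integrality from norms to traces.
  trd-via-nrd : (x : Quaternion a b) → trd x ≡ nrd (1ᴮ +ᴮ x) ℚ.+ (ℚ.- 1ℚ) ℚ.* (nrd x ℚ.+ 1ℚ)
  trd-via-nrd x = prove (env 0ℚ 0ℚ x 0ᴮ 0ᴮ) (trdᴾ 𝕩)
    (nrdᴾ 𝕒 𝕓 (constᴾ 1ℚ +ᴾ 𝕩) :+ con (ℚ.- 1ℚ) :* (nrdᴾ 𝕒 𝕓 𝕩 :+ con 1ℚ)) refl

  ·-zeroʳ : ∀ q → q · 0ᴮ ≡ 0ᴮ {a} {b}
  ·-zeroʳ q = prove-quat (env 0ℚ q 0ᴮ 0ᴮ 0ᴮ) (𝕢 ·ᴾ constᴾ 0ℚ) (constᴾ 0ℚ) refl refl refl refl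

  ·-zeroˡ : (x : Quaternion a b) → 0ℚ · x ≡ 0ᴮ
  ·-zeroˡ x = prove-quat (env 0ℚ 0ℚ x 0ᴮ 0ᴮ) (con 0ℚ ·ᴾ 𝕩) (constᴾ 0ℚ) refl refl refl refl

  ·-identity : (x : Quaternion a b) → 1ℚ · x ≡ x
  ·-identity x = prove-quat (env 0ℚ 0ℚ x 0ᴮ 0ᴮ) (con 1ℚ ·ᴾ 𝕩) 𝕩 refl refl refl refl

  +ᴮ-identityˡ : (x : Quaternion a b) → 0ᴮ +ᴮ x ≡ x
  +ᴮ-identityˡ x = prove-quat (env 0ℚ 0ℚ x 0ᴮ 0ᴮ) (constᴾ 0ℚ +ᴾ 𝕩) 𝕩 refl refl refl refl

  +ᴮ-identityʳ : (x : Quaternion a b) → x +ᴮ 0ᴮ ≡ x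
  +ᴮ-identityʳ x = prove-quat (env 0ℚ 0ℚ x 0ᴮ 0ᴮ) (𝕩 +ᴾ constᴾ 0ℚ) 𝕩 refl refl refl refl

  ·-distribˡ-+ᴮ-assoc : ∀ p q (x y : Quaternion a b) → p · (q · x +ᴮ y) ≡ (p ℚ.* q) · x +ᴮ p · y
  ·-distribˡ-+ᴮ-assoc p q x y = prove-quat (env p q x y 0ᴮ)
    (𝕡 ·ᴾ ((𝕢 ·ᴾ 𝕩) +ᴾ 𝕪)) (((𝕡 :* 𝕢) ·ᴾ 𝕩) +ᴾ (𝕡 ·ᴾ 𝕪)) refl refl refl refl

  ·-distribʳ-+-interchange : ∀ p q (x y z : Quaternion a b) →
    (p ℚ.+ q) · x +ᴮ (y +ᴮ z) ≡ (p · x +ᴮ y) +ᴮ (q · x +ᴮ z)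
  ·-distribʳ-+-interchange p q x y z = prove-quat (env p q x y z)
    (((𝕡 :+ 𝕢) ·ᴾ 𝕩) +ᴾ (𝕪 +ᴾ 𝕫)) (((𝕡 ·ᴾ 𝕩) +ᴾ 𝕪) +ᴾ ((𝕢 ·ᴾ 𝕩) +ᴾ 𝕫)) refl refl refl refl

  *ᴮ-scalar : ∀ (x : Quaternion a b) q → x *ᴮ scalar q ≡ q · x
  *ᴮ-scalar x q = prove-quat (env 0ℚ q x 0ᴮ 0ᴮ) (mulᴾ 𝕒 𝕓 𝕩 (quatᴾ 𝕢 (con 0ℚ) (con 0ℚ) (con 0ℚ))) (𝕢 ·ᴾ 𝕩)
    refl refl refl refl

  *ᴮ-identityʳ : (x : Quaternion a b) → x *ᴮ 1ᴮ ≡ x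
  *ᴮ-identityʳ x = trans (*ᴮ-scalar x 1ℚ) (·-identity x)

open RawMonoidOps ℚ.+-0-rawMonoid using (sum)
open RawMonoidOps (+ᴮ-rawMonoid {ℚ.- 1ℚ} {+ 3 / 1}) using () renaming (sum to sumᴮ)
open Vector using ([]; _∷_)

-- Linear maps on `B₆`

std : Vector B₆ 4
std = quat 1ℚ 0ℚ 0ℚ 0ℚ ∷ quat 0ℚ 1ℚ 0ℚ 0ℚ ∷ quat 0ℚ 0ℚ 1ℚ 0ℚ ∷ quat 0ℚ 0ℚ 0ℚ 1ℚ ∷ []

record IsLinear (F : B₆ → B₆) : Set where
  field
    +-homo : ∀ x y → F (x +ᴮ y) ≡ F x +ᴮ F y
    ·-homo : ∀ q x → F (q · x) ≡ q · F x

open IsLinear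

std-expansion : (x : B₆) →
  x ≡ re x · std 0F +ᴮ (im-i x · std 1F +ᴮ (im-j x · std 2F +ᴮ im-ij x · std 3F))
std-expansion (quat t x y z) = quat-≡
  (solve 4 (λ t x y z → t := t :* con 1ℚ :+ (x :* con 0ℚ :+ (y :* con 0ℚ :+ z :* con 0ℚ))) refl t x y z)
  (solve 4 (λ t x y z → x := t :* con 0ℚ :+ (x :* con 1ℚ :+ (y :* con 0ℚ :+ z :* con 0ℚ))) refl t x y z)
  (solve 4 (λ t x y z → y := t :* con 0ℚ :+ (x :* con 0ℚ :+ (y :* con 1ℚ :+ z :* con 0ℚ))) refl t x y z)
  (solve 4 (λ t x y z → z := t :* con 0ℚ :+ (x :* con 0ℚ :+ (y :* con 0ℚ :+ z :* con 1ℚ))) refl t x y z)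
  where open ℚ-Solver

-- Reduces an identity between linear maps to four closed equations, which are then decided by
-- computation.
linear-ext : ∀ {F G} → IsLinear F → IsLinear G →
  (∀ k → F (std k) ≡ G (std k)) → ∀ x → F x ≡ G x
linear-ext {F} {G} F-lin G-lin agree x = begin
  F x         ≡⟨ image F-lin ⟩
  _           ≡⟨ cong₂ _+ᴮ_ (cong (re x ·_) (agree 0F)) (cong₂ _+ᴮ_ (cong (im-i x ·_) (agree 1F))
                  (cong₂ _+ᴮ_ (cong (im-j x ·_) (agree 2F)) (cong (im-ij x ·_) (agree 3F)))) ⟩
  _           ≡⟨ image G-lin ⟨
  G x         ∎
  where
  open ≡-Reasoning
  image : ∀ {H} → IsLinear H → H x ≡
    re x · H (std 0F) +ᴮ (im-i x · H (std 1F) +ᴮ (im-j x · H (std 2F) +ᴮ im-ij x · H (std 3F)))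
  image {H} lin = begin
    H x ≡⟨ cong H (std-expansion x) ⟩
    _   ≡⟨ lin .+-homo (re x · std 0F) (im-i x · std 1F +ᴮ (im-j x · std 2F +ᴮ im-ij x · std 3F)) ⟩
    _   ≡⟨ cong₂ _+ᴮ_ (lin .·-homo (re x) (std 0F))
             (lin .+-homo (im-i x · std 1F) (im-j x · std 2F +ᴮ im-ij x · std 3F)) ⟩
    _   ≡⟨ cong (re x · H (std 0F) +ᴮ_) (cong₂ _+ᴮ_ (lin .·-homo (im-i x) (std 1F))
             (trans (lin .+-homo (im-j x · std 2F) (im-ij x · std 3F))
               (cong₂ _+ᴮ_ (lin .·-homo (im-j x) (std 2F)) (lin .·-homo (im-ij x) (std 3F))))) ⟩
    _   ∎

id-linear : IsLinear id
id-linear .+-homo _ _ = refl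
id-linear .·-homo _ _ = refl

*ᴮˡ-linear : ∀ u → IsLinear (u *ᴮ_)
*ᴮˡ-linear u .+-homo = *ᴮ-distribˡ-+ᴮ u
*ᴮˡ-linear u .·-homo q = *ᴮ-·-comm q u

*ᴮʳ-linear : ∀ u → IsLinear (_*ᴮ u)
*ᴮʳ-linear u .+-homo x y = *ᴮ-distribʳ-+ᴮ x y u
*ᴮʳ-linear u .·-homo q x = ·-*ᴮ-assoc q x u

∘-linear : ∀ {F G} → IsLinear F → IsLinear G → IsLinear (F ∘ G)
∘-linear {F} {G} F-lin G-lin .+-homo x y = trans (cong F (G-lin .+-homo x y)) (F-lin .+-homo (G x) (G y))
∘-linear {F} {G} F-lin G-lin .·-homo q x = trans (cong F (G-lin .·-homo q x)) (F-lin .·-homo q (G x))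

-- If `e*` is the basis trace-dual to `e`, then trd (x e*ₖ) is the k-th coordinate of x in `e`, and
-- this map is the identity.
expand : ∀ {n} → Vector B₆ n → Vector B₆ n → B₆ → B₆
expand e e* x = sumᴮ λ k → trd (x *ᴮ e* k) · e k

expand-linear : ∀ {n} (e e* : Vector B₆ n) → IsLinear (expand e e*)
expand-linear {zero} e e* .+-homo x y = refl
expand-linear {zero} e e* .·-homo q x = sym (·-zeroʳ q)
expand-linear {suc n} e e* .+-homo x y = begin
  trd ((x +ᴮ y) *ᴮ e* zero) · e zero +ᴮ expand (e ∘ suc) (e* ∘ suc) (x +ᴮ y)
    ≡⟨ cong₂ (λ p q → p · e zero +ᴮ q)
         (trans (cong trd (*ᴮ-distribʳ-+ᴮ x y (e* zero))) (trd-+ᴮ (x *ᴮ e* zero) (y *ᴮ e* zero)))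
         (expand-linear (e ∘ suc) (e* ∘ suc) .+-homo x y) ⟩
  (trd (x *ᴮ e* zero) ℚ.+ trd (y *ᴮ e* zero)) · e zero
    +ᴮ (expand (e ∘ suc) (e* ∘ suc) x +ᴮ expand (e ∘ suc) (e* ∘ suc) y)
    ≡⟨ ·-distribʳ-+-interchange (trd (x *ᴮ e* zero)) (trd (y *ᴮ e* zero)) (e zero)
         (expand (e ∘ suc) (e* ∘ suc) x) (expand (e ∘ suc) (e* ∘ suc) y) ⟩
  expand e e* x +ᴮ expand e e* y ∎
  where open ≡-Reasoning
expand-linear {suc n} e e* .·-homo q x = begin
  trd (q · x *ᴮ e* zero) · e zero +ᴮ expand (e ∘ suc) (e* ∘ suc) (q · x)
    ≡⟨ cong₂ (λ p r → p · e zero +ᴮ r)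
         (trans (cong trd (·-*ᴮ-assoc q x (e* zero))) (trd-· q (x *ᴮ e* zero)))
         (expand-linear (e ∘ suc) (e* ∘ suc) .·-homo q x) ⟩
  (q ℚ.* trd (x *ᴮ e* zero)) · e zero +ᴮ q · expand (e ∘ suc) (e* ∘ suc) x
    ≡⟨ ·-distribˡ-+ᴮ-assoc q (trd (x *ᴮ e* zero)) (e zero) (expand (e ∘ suc) (e* ∘ suc) x) ⟨
  q · expand e e* x ∎
  where open ≡-Reasoning

-- ℤ-submodules of B₆

record IsSubmodule (P : Subset) : Set where
  field
    0-closed : P 0ᴮ
    +-closed : ∀ {x y} → P x → P y → P (x +ᴮ y)
    ·-closed : ∀ c {x} → P x → P (toℚ c · x)

open IsSubmodule

combination∈ : ∀ {P} → IsSubmodule P → ∀ {n} (c : Vector ℤ n) {e : Vector B₆ n} →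
  (∀ k → P (e k)) → P (combination c e)
combination∈ P {zero}  c e∈P = P .0-closed
combination∈ P {suc n} c e∈P =
  P .+-closed (P .·-closed (c zero) (e∈P zero)) (combination∈ P (c ∘ suc) (e∈P ∘ suc))

span-⊆ : ∀ {P} → IsSubmodule P → ∀ {n} {e : Vector B₆ n} → (∀ k → P (e k)) → span e ⊆ P
span-⊆ P e∈P (c , refl) = combination∈ P c e∈P

0·x+y≡y : (x y : B₆) → 0ℚ · x +ᴮ y ≡ y
0·x+y≡y x y = trans (cong (_+ᴮ y) (·-zeroˡ x)) (+ᴮ-identityˡ y)

zero-combination : ∀ {n} (e : Vector B₆ n) → combination (λ _ → + 0) e ≡ 0ᴮ
zero-combination {zero}  e = refl
zero-combination {suc n} e = trans (0·x+y≡y (e zero) _) (zero-combination (e ∘ suc))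

span-submodule : ∀ {n} (e : Vector B₆ n) → IsSubmodule (span e)
span-submodule e .0-closed = (λ _ → + 0) , sym (zero-combination e)
span-submodule e .+-closed {x} {y} (c , p) (d , q) = (λ k → c k ℤ.+ d k) ,
  trans (cong₂ _+ᴮ_ p q) (sym (+-combination c d e))
  where
  +-combination : ∀ {n} (c d : Vector ℤ n) (e : Vector B₆ n) →
    combination (λ k → c k ℤ.+ d k) e ≡ combination c e +ᴮ combination d e
  +-combination {zero}  c d e = refl
  +-combination {suc n} c d e = trans
    (cong₂ (λ p q → p · e zero +ᴮ q) (toℚ-+ (c zero) (d zero)) (+-combination (c ∘ suc) (d ∘ suc) (e ∘ suc)))
    (·-distribʳ-+-interchange (toℚ (c zero)) (toℚ (d zero)) (e zero)
      (combination (c ∘ suc) (e ∘ suc)) (combination (d ∘ suc) (e ∘ suc)))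
span-submodule e .·-closed m {x} (c , p) = (λ k → m ℤ.* c k) ,
  trans (cong (toℚ m ·_) p) (·-combination c e)
  where
  ·-combination : ∀ {n} (c : Vector ℤ n) (e : Vector B₆ n) →
    toℚ m · combination c e ≡ combination (λ k → m ℤ.* c k) e
  ·-combination {zero}  c e = ·-zeroʳ (toℚ m)
  ·-combination {suc n} c e = trans
    (·-distribˡ-+ᴮ-assoc (toℚ m) (toℚ (c zero)) (e zero) (combination (c ∘ suc) (e ∘ suc)))
    (cong₂ (λ p q → p · e zero +ᴮ q) (sym (toℚ-* m (c zero))) (·-combination (c ∘ suc) (e ∘ suc)))

≐-submodule : ∀ {P Q} → P ≐ Q → IsSubmodule Q → IsSubmodule P
≐-submodule (P⊆Q , Q⊆P) Q-sub .0-closed = Q⊆P (Q-sub .0-closed)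
≐-submodule (P⊆Q , Q⊆P) Q-sub .+-closed x∈P y∈P = Q⊆P (Q-sub .+-closed (P⊆Q x∈P) (P⊆Q y∈P))
≐-submodule (P⊆Q , Q⊆P) Q-sub .·-closed c x∈P = Q⊆P (Q-sub .·-closed c (P⊆Q x∈P))

preimage-submodule : ∀ {P F} → IsLinear F → IsSubmodule P → IsSubmodule (P ∘ F)
preimage-submodule {P} {F} F-lin P-sub .0-closed =
  subst P (sym (trans (F-lin .·-homo 0ℚ 0ᴮ) (·-zeroˡ (F 0ᴮ)))) (P-sub .0-closed)
preimage-submodule {P} F-lin P-sub .+-closed {x} {y} x∈ y∈ =
  subst P (sym (F-lin .+-homo x y)) (P-sub .+-closed x∈ y∈)
preimage-submodule {P} F-lin P-sub .·-closed c {x} x∈ =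
  subst P (sym (F-lin .·-homo (toℚ c) x)) (P-sub .·-closed c x∈)

basis∈span : ∀ {n} (e : Vector B₆ n) k → e k ∈ span e
basis∈span e zero = (+ 1 ∷ λ _ → + 0) , sym (begin
  1ℚ · e zero +ᴮ combination (λ _ → + 0) (e ∘ suc)
    ≡⟨ cong₂ _+ᴮ_ (·-identity (e zero)) (zero-combination (e ∘ suc)) ⟩
  e zero +ᴮ 0ᴮ   ≡⟨ +ᴮ-identityʳ (e zero) ⟩
  e zero         ∎)
  where open ≡-Reasoning
basis∈span e (suc k) with basis∈span (e ∘ suc) k
... | c , eₖ≡ = (+ 0 ∷ c) , trans eₖ≡ (sym (0·x+y≡y (e zero) _))

-- Bilinearity, one factor at a time: the elements that a fixed left or right multiplication sends
-- into `span e` form a submodule, so testing the basis vectors is enough.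
*-closed-span : ∀ {n} (e : Vector B₆ n) → (∀ i j → e i *ᴮ e j ∈ span e) →
  ∀ {x y} → x ∈ span e → y ∈ span e → x *ᴮ y ∈ span e
*-closed-span e products {x} {y} x∈ y∈ =
  span-⊆ (preimage-submodule (*ᴮʳ-linear y) (span-submodule e))
    (λ i → span-⊆ (preimage-submodule (*ᴮˡ-linear (e i)) (span-submodule e)) (products i) y∈) x∈

-- The dual lattice of `span h`, cut out by finitely many traces. Lattices are described both by
-- generators and by such conditions: inclusions from a lattice are checked on generators,
-- inclusions into it on conditions.
IntegralOn : ∀ {n} → Vector B₆ n → Subset
IntegralOn h x = ∀ k → Integer (trd (x *ᴮ h k))

integer-trd-submodule : IsSubmodule (Integer ∘ trd)
integer-trd-submodule .0-closed = + 0 , refl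
integer-trd-submodule .+-closed {x} {y} x∈ y∈ = subst Integer (sym (trd-+ᴮ x y)) (integer-+ x∈ y∈)
integer-trd-submodule .·-closed c {x} x∈ = subst Integer (sym (trd-· (toℚ c) x)) (integer-* (c , refl) x∈)

integer-trd-*ʳ-submodule : ∀ y → IsSubmodule λ x → Integer (trd (x *ᴮ y))
integer-trd-*ʳ-submodule y = preimage-submodule (*ᴮʳ-linear y) integer-trd-submodule

integralOn-submodule : ∀ {n} (h : Vector B₆ n) → IsSubmodule (IntegralOn h)
integralOn-submodule h .0-closed k = integer-trd-*ʳ-submodule (h k) .0-closed
integralOn-submodule h .+-closed {x} {y} x∈ y∈ k = integer-trd-*ʳ-submodule (h k) .+-closed {x} {y} (x∈ k) (y∈ k)
integralOn-submodule h .·-closed c {x} x∈ k = integer-trd-*ʳ-submodule (h k) .·-closed c {x} (x∈ k)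

integralOn-span : ∀ {n} {h : Vector B₆ n} {x} → IntegralOn h x → ∀ {y} → y ∈ span h → Integer (trd (x *ᴮ y))
integralOn-span {x = x} x∈ = span-⊆ (preimage-submodule (*ᴮˡ-linear x) integer-trd-submodule) x∈

dual-span : ∀ {n} {O : Subset} (e : Vector B₆ n) → O ≐ span e → (O ♯) ≐ IntegralOn e
dual-span e (O⊆ , ⊆O) =
  (λ x∈ k → x∈ (e k) (⊆O (basis∈span e k))) , (λ {x} x∈ y y∈O → integralOn-span {h = e} {x} x∈ (O⊆ y∈O))

trd-combination : ∀ {n} (c : Vector ℤ n) (e : Vector B₆ n) y →
  trd (combination c e *ᴮ y) ≡ sum λ k → toℚ (c k) ℚ.* trd (e k *ᴮ y)
trd-combination {zero}  c e y = cong trd (begin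
  0ᴮ *ᴮ y           ≡⟨ cong (_*ᴮ y) (·-zeroˡ 0ᴮ) ⟨
  (0ℚ · 0ᴮ) *ᴮ y    ≡⟨ ·-*ᴮ-assoc 0ℚ 0ᴮ y ⟩
  0ℚ · (0ᴮ *ᴮ y)    ≡⟨ ·-zeroˡ (0ᴮ *ᴮ y) ⟩
  0ᴮ                ∎)
  where open ≡-Reasoning
trd-combination {suc n} c e y = begin
  trd ((c₀ · e zero +ᴮ rest) *ᴮ y)               ≡⟨ cong trd (*ᴮ-distribʳ-+ᴮ (c₀ · e zero) rest y) ⟩
  trd ((c₀ · e zero) *ᴮ y +ᴮ rest *ᴮ y)          ≡⟨ trd-+ᴮ ((c₀ · e zero) *ᴮ y) (rest *ᴮ y) ⟩
  trd ((c₀ · e zero) *ᴮ y) ℚ.+ trd (rest *ᴮ y)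
    ≡⟨ cong₂ ℚ._+_ (trans (cong trd (·-*ᴮ-assoc c₀ (e zero) y)) (trd-· c₀ (e zero *ᴮ y)))
         (trd-combination (c ∘ suc) (e ∘ suc) y) ⟩
  c₀ ℚ.* trd (e zero *ᴮ y) ℚ.+ sum (λ k → toℚ (c (suc k)) ℚ.* trd (e (suc k) *ᴮ y)) ∎
  where
  open ≡-Reasoning
  c₀ = toℚ (c zero)
  rest = combination (c ∘ suc) (e ∘ suc)

-- Trace-dual bases

-- Biorthogonality makes traces against `e*` read off coordinates in `e`, whence independence. The
-- second condition extends by linearity to every quaternion, so that `e` also generates `B₆` over
-- ℚ. Both are finite checks on closed numbers.
IsDual : Vector B₆ 4 → Vector B₆ 4 → Set
IsDual e e* =
    (∀ i j → trd (e i *ᴮ e* j) ≡ Matℚ.Id i j)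
  × (∀ k → expand e e* (std k) ≡ std k)

isDual? : ∀ e e* → Dec (IsDual e e*)
isDual? e e* =
  Fin.all? (λ i → Fin.all? λ j → trd (e i *ᴮ e* j) ℚ.≟ Matℚ.Id i j)
  ×-dec Fin.all? (λ k → expand e e* (std k) ≟ᴮ std k)

sum-Id : (c : Vector ℤ 4) (j : Fin 4) → sum (λ i → toℚ (c i) ℚ.* Matℚ.Id i j) ≡ toℚ (c j)
sum-Id c 0F = solve 4 (λ p q r s → p :* con 1ℚ :+ (q :* con 0ℚ :+ (r :* con 0ℚ :+ (s :* con 0ℚ :+ con 0ℚ))) := p)
  refl (toℚ (c 0F)) (toℚ (c 1F)) (toℚ (c 2F)) (toℚ (c 3F))
  where open ℚ-Solver
sum-Id c 1F = solve 4 (λ p q r s → p :* con 0ℚ :+ (q :* con 1ℚ :+ (r :* con 0ℚ :+ (s :* con 0ℚ :+ con 0ℚ))) := q)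
  refl (toℚ (c 0F)) (toℚ (c 1F)) (toℚ (c 2F)) (toℚ (c 3F))
  where open ℚ-Solver
sum-Id c 2F = solve 4 (λ p q r s → p :* con 0ℚ :+ (q :* con 0ℚ :+ (r :* con 1ℚ :+ (s :* con 0ℚ :+ con 0ℚ))) := r)
  refl (toℚ (c 0F)) (toℚ (c 1F)) (toℚ (c 2F)) (toℚ (c 3F))
  where open ℚ-Solver
sum-Id c 3F = solve 4 (λ p q r s → p :* con 0ℚ :+ (q :* con 0ℚ :+ (r :* con 0ℚ :+ (s :* con 1ℚ :+ con 0ℚ))) := s)
  refl (toℚ (c 0F)) (toℚ (c 1F)) (toℚ (c 2F)) (toℚ (c 3F))
  where open ℚ-Solver

sum-cong : ∀ {n} {s t : Vector ℚ n} → (∀ k → s k ≡ t k) → sum s ≡ sum t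
sum-cong {zero}  s≗t = refl
sum-cong {suc n} s≗t = cong₂ ℚ._+_ (s≗t zero) (sum-cong (s≗t ∘ suc))

module Dual (e e* : Vector B₆ 4) (isDual : IsDual e e*) where

  coordinate : ∀ c j → trd (combination c e *ᴮ e* j) ≡ toℚ (c j)
  coordinate c j = begin
    trd (combination c e *ᴮ e* j)                 ≡⟨ trd-combination c e (e* j) ⟩
    sum (λ i → toℚ (c i) ℚ.* trd (e i *ᴮ e* j))   ≡⟨ sum-cong (λ i → cong (toℚ (c i) ℚ.*_) (proj₁ isDual i j)) ⟩
    sum (λ i → toℚ (c i) ℚ.* Matℚ.Id i j)         ≡⟨ sum-Id c j ⟩
    toℚ (c j)                                     ∎
    where open ≡-Reasoning

  expand-id : ∀ x → expand e e* x ≡ x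
  expand-id = linear-ext (expand-linear e e*) id-linear (proj₂ isDual)

  independent : ∀ c → combination c e ≡ 0ᴮ → ∀ k → c k ≡ + 0
  independent c c·e≡0 k = toℚ-injective (begin
    toℚ (c k)                       ≡⟨ coordinate c k ⟨
    trd (combination c e *ᴮ e* k)   ≡⟨ cong (λ x → trd (x *ᴮ e* k)) (trans c·e≡0 (sym (zero-combination e))) ⟩
    trd (combination (λ _ → + 0) e *ᴮ e* k) ≡⟨ coordinate (λ _ → + 0) k ⟩
    0ℚ                              ∎)
    where open ≡-Reasoning

  -- Coordinates in `e` are the traces against `e*`, so integral coordinates and integral traces are
  -- the same condition.
  span≐integralOn : span e ≐ IntegralOn e*
  span≐integralOn = (λ { (c , refl) k → c k , coordinate c k }) , λ {x} x∈ →
    (proj₁ ∘ x∈) , trans (sym (expand-id x)) (expand-combination e e* x x∈)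
    where
    expand-combination : ∀ {n} (e e* : Vector B₆ n) x (x∈ : IntegralOn e* x) →
      expand e e* x ≡ combination (proj₁ ∘ x∈) e
    expand-combination {zero}  e e* x x∈ = refl
    expand-combination {suc n} e e* x x∈ = cong₂ (λ q y → q · e zero +ᴮ y) (proj₂ (x∈ zero))
      (expand-combination (e ∘ suc) (e* ∘ suc) x (x∈ ∘ suc))

  isBasis : ∀ {L} → L ≐ span e → IsBasis L e
  isBasis L≐ = record { spanning = L≐ ; independent = independent }

  module _ (e*₀≡1 : e* zero ≡ 1ᴮ) where

    trd≡coordinate₀ : ∀ x → trd x ≡ trd (x *ᴮ e* zero)
    trd≡coordinate₀ x = cong trd (trans (sym (*ᴮ-identityʳ x)) (cong (x *ᴮ_) (sym e*₀≡1)))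

    cons₀ : ∀ (c : Vector ℤ 3) → combination (+ 0 ∷ c) e ≡ combination c (e ∘ suc)
    cons₀ c = 0·x+y≡y (e zero) (combination c (e ∘ suc))

    -- Since `e*` starts with 1, the trace of x is its zeroth coordinate in `e`; trace zero just
    -- deletes that basis vector.
    traceless-isBasis : ∀ {L} → L ≐ span e → IsBasis (L ₀) (e ∘ suc)
    traceless-isBasis {L} (L⊆ , ⊆L) = record
      { spanning    = fwd , bwd
      ; independent = λ c c·e≡0 k → independent (+ 0 ∷ c) (trans (cons₀ c) c·e≡0) (suc k)
      }
      where
      open ≡-Reasoning
      fwd : (L ₀) ⊆ span (e ∘ suc)
      fwd {x} (x∈L , trdx≡0) with L⊆ x∈L
      ... | c , refl = (c ∘ suc) , (begin
        toℚ (c zero) · e zero +ᴮ combination (c ∘ suc) (e ∘ suc)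
          ≡⟨ cong (λ q → q · e zero +ᴮ combination (c ∘ suc) (e ∘ suc)) c₀≡0 ⟩
        0ℚ · e zero +ᴮ combination (c ∘ suc) (e ∘ suc)
          ≡⟨ 0·x+y≡y (e zero) (combination (c ∘ suc) (e ∘ suc)) ⟩
        combination (c ∘ suc) (e ∘ suc) ∎)
        where
        c₀≡0 : toℚ (c zero) ≡ 0ℚ
        c₀≡0 = trans (sym (coordinate c zero)) (trans (sym (trd≡coordinate₀ (combination c e))) trdx≡0)
      bwd : span (e ∘ suc) ⊆ (L ₀)
      bwd (c , refl) = ⊆L (+ 0 ∷ c , sym (cons₀ c)) , (begin
        trd (combination c (e ∘ suc))              ≡⟨ cong trd (cons₀ c) ⟨
        trd (combination (+ 0 ∷ c) e)              ≡⟨ trd≡coordinate₀ (combination (+ 0 ∷ c) e) ⟩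
        trd (combination (+ 0 ∷ c) e *ᴮ e* zero)   ≡⟨ coordinate (+ 0 ∷ c) zero ⟩
        0ℚ                                         ∎)

≐-trans : ∀ {P Q R : Subset} → P ≐ Q → Q ≐ R → P ≐ R
≐-trans (P⊆Q , Q⊆P) (Q⊆R , R⊆Q) = (λ x∈ → Q⊆R (P⊆Q x∈)) , (λ x∈ → Q⊆P (R⊆Q x∈))

≐-sym : ∀ {P Q : Subset} → P ≐ Q → Q ≐ P
≐-sym (P⊆Q , Q⊆P) = Q⊆P , P⊆Q

-- Traces against the dual basis are the coordinates sought, and their numerators are those
-- coordinates whenever the traces are integers. Integrality is not proved beforehand, because
-- `inSpan?` verifies the resulting combination.
coefficients : ∀ {m n} → Vector B₆ n → Vector B₆ m → Fin m → Vector ℤ n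
coefficients e* x i j = ↥ trd (x i *ᴮ e* j)

inSpan? : ∀ {m n} (e : Vector B₆ n) (x : Vector B₆ m) (A : Fin m → Vector ℤ n) →
  Dec (∀ i → x i ≡ combination (A i) e)
inSpan? e x A = Fin.all? λ i → x i ≟ᴮ combination (A i) e

inSpan : ∀ {m n} (e : Vector B₆ n) (x : Vector B₆ m) (A : Fin m → Vector ℤ n) →
  {True (inSpan? e x A)} → ∀ i → x i ∈ span e
inSpan e x A {ok} i = A i , toWitness ok i

integralOn-antitone : ∀ {m n} (g : Vector B₆ m) (h : Vector B₆ n) →
  (∀ k → g k ∈ span h) → IntegralOn h ⊆ IntegralOn g
integralOn-antitone g h g∈ {x} x∈ k = integralOn-span {h = h} {x} x∈ (g∈ k)

integralOn-cong : ∀ {m n} (g : Vector B₆ m) (h : Vector B₆ n) →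
  (∀ k → h k ∈ span g) → (∀ k → g k ∈ span h) → IntegralOn g ≐ IntegralOn h
integralOn-cong g h h∈ g∈ =
  (λ {x} → integralOn-antitone h g h∈ {x}) , (λ {x} → integralOn-antitone g h g∈ {x})

-- trd x is even exactly when trd (x · ½) is an integer, so evenness is one more trace condition.
evenTrace-integralOn : ∀ {n O} (e* : Vector B₆ n) → O ≐ IntegralOn e* →
  evenTrace O ≐ IntegralOn (scalar ½ ∷ e*)
evenTrace-integralOn {O = O} e* (O⊆ , ⊆O) = fwd , bwd
  where
  trd-half : (x : B₆) → trd (x *ᴮ scalar ½) ≡ ½ ℚ.* trd x
  trd-half x = trans (cong trd (*ᴮ-scalar x ½)) (trd-· ½ x)
  fwd : evenTrace O ⊆ IntegralOn (scalar ½ ∷ e*)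
  fwd {x} (x∈O , z , trdx≡2z) zero = z , (begin
    trd (x *ᴮ scalar ½)           ≡⟨ trd-half x ⟩
    ½ ℚ.* trd x                   ≡⟨ cong (½ ℚ.*_) (trans trdx≡2z (toℚ-* (+ 2) z)) ⟩
    ½ ℚ.* (toℚ (+ 2) ℚ.* toℚ z)   ≡⟨ ℚ.*-assoc ½ (toℚ (+ 2)) (toℚ z) ⟨
    1ℚ ℚ.* toℚ z                  ≡⟨ ℚ.*-identityˡ (toℚ z) ⟩
    toℚ z                         ∎)
    where open ≡-Reasoning
  fwd (x∈O , _) (suc k) = O⊆ x∈O k
  bwd : IntegralOn (scalar ½ ∷ e*) ⊆ evenTrace O
  bwd {x} x∈ = ⊆O (x∈ ∘ suc) , proj₁ (x∈ zero) , (begin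
    trd x                                ≡⟨ ℚ.*-identityˡ (trd x) ⟨
    1ℚ ℚ.* trd x                         ≡⟨ ℚ.*-assoc (toℚ (+ 2)) ½ (trd x) ⟩
    toℚ (+ 2) ℚ.* (½ ℚ.* trd x)          ≡⟨ cong (toℚ (+ 2) ℚ.*_) (trans (sym (trd-half x)) (proj₂ (x∈ zero))) ⟩
    toℚ (+ 2) ℚ.* toℚ (proj₁ (x∈ zero))  ≡⟨ toℚ-* (+ 2) (proj₁ (x∈ zero)) ⟨
    toℚ (+ 2 ℤ.* proj₁ (x∈ zero))        ∎)
    where open ≡-Reasoning

-- Genera

module _ (p : ℕ) where
  open ℤₚ
  private module Mₚ = Matℤₚ p

  constₚ-mat : Matℤ.Matrix 3 → Mₚ.Matrix 3
  constₚ-mat A i j = constₚ (A i j)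

  approx-≡⇒≋ : (A B : Mₚ.Matrix 3) → (∀ i j n → approx (A i j) n ≡ approx (B i j) n) → A Mₚ.≋ B
  approx-≡⇒≋ A B A≗B i j n =
    divides (+ 0) (trans (cong (ℤ._- approx (B i j) n) (A≗B i j n)) (ℤ.+-inverseʳ (approx (B i j) n)))

  -- Both identity matrices are stuck on the test `i Fin.≟ j` for variable indices; splitting on it
  -- makes them agree.
  Id-approx : ∀ (i j : Fin 3) n → approx (Mₚ.Id i j) n ≡ Matℤ.Id i j
  Id-approx i j n with i Fin.≟ j
  ... | yes _ = refl
  ... | no  _ = refl

  -- The operations of `ℤₚ` act level by level, so at every level a product of constant matrices
  -- computes to the integral product. One integral isometry therefore serves at every p.
  isometricₚ : ∀ (A B : Matℤ.Matrix 3) → Matℤ.Isometric A B → Mₚ.Isometric (constₚ-mat A) (constₚ-mat B)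
  isometricₚ A B (T , (S , TS , ST) , TAT) = Tₚ
    , (Sₚ , approx-≡⇒≋ (Tₚ Mₚ.⊗ Sₚ) Mₚ.Id (λ i j n → trans (TS i j) (sym (Id-approx i j n)))
          , approx-≡⇒≋ (Sₚ Mₚ.⊗ Tₚ) Mₚ.Id (λ i j n → trans (ST i j) (sym (Id-approx i j n))))
    , approx-≡⇒≋ (((Tₚ Mₚ.ᵀ) Mₚ.⊗ constₚ-mat A) Mₚ.⊗ Tₚ) (constₚ-mat B) (λ i j n → TAT i j)
    where
    Tₚ = constₚ-mat T
    Sₚ = constₚ-mat S

-- Orders given by a pair of dual bases

products : ∀ {n} → Vector B₆ n → Fin n → Vector B₆ n
products f i j = f i *ᴮ f j

-- Duality enters in both directions: `fe` makes `f` a basis of `O`, while `ef` makes `e` a basis of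
-- the dual lattice `O ♯`.
module Order {O : Subset} (f e : Vector B₆ 4) (O≐ : O ≐ span f)
  (fe : IsDual f e) (ef : IsDual e f) (f₀≡1 : f zero ≡ 1ᴮ) where

  basis : IsBasis O f
  basis = Dual.isBasis f e fe O≐

  isOrder : (∀ i j → products f i j ∈ span f) → IsOrder O
  isOrder closed = record
    { lattice  = f , basis
    ; one      = proj₂ O≐ (subst (span f) f₀≡1 (basis∈span f zero))
    ; *-closed = λ x∈ y∈ → proj₂ O≐ (*-closed-span f closed (proj₁ O≐ x∈) (proj₁ O≐ y∈))
    }

  ♯≐span : (O ♯) ≐ span e
  ♯≐span = ≐-trans (dual-span f O≐) (≐-sym (Dual.span≐integralOn e f ef))

  correspondsTo : ∀ d (G : Matℤ.Matrix 3) →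
    toℚ (+ (d ℕ.* d)) ≡ ℚ.∣ Matℚ.det (λ i j → trd (f i *ᴮ f j)) ∣ →
    (∀ i j → bilinear (ℚ.- toℚ (+ d)) (e (suc i)) (e (suc j)) ≡ toℚ (G i j)) →
    (∀ i → + 2 ∣ G i i) → HasSignature G 2 1 → Matℤ.Isometric G G → CorrespondsTo O d G
  correspondsTo d G disc gram even sig iso = (f , basis , disc) , record
    { basis   = e ∘ suc
    ; isBasis = Dual.traceless-isBasis e f ef f₀≡1 ♯≐span
    ; gram    = G
    ; gram-eq = gram
    ; even    = even
    ; inGenus = (2 , 1 , sig , sig) , λ p _ → isometricₚ p G G iso
    }

-- The four orders

-- eₙ is the basis dual to fₙ under the trace form.  Since fₙ 0 = 1, its last three
-- vectors have trace zero; they are chosen to have Gram matrix exactly Gₙ.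
f₁ e₁ : Vector B₆ 4
f₁ =
  ( 1ᴮ
  ∷ quat (-[1+ 0 ] / 1) (-[1+ 0 ] / 1) 0ℚ 0ℚ
  ∷ quat (-[1+ 2 ] / 2) (-[1+ 2 ] / 2) -½ -½
  ∷ quat (-[1+ 2 ] / 1) (-[1+ 2 ] / 1) 0ℚ (-[1+ 0 ] / 1)
  ∷ [])
e₁ =
  ( quat ½ ½ 0ℚ 0ℚ
  ∷ quat 0ℚ ½ 0ℚ ½
  ∷ quat 0ℚ 0ℚ (-[1+ 0 ] / 3) 0ℚ
  ∷ quat 0ℚ 0ℚ (+ 1 / 6) (-[1+ 0 ] / 6)
  ∷ [])

f₁e₁-dual : IsDual f₁ e₁
f₁e₁-dual = from-yes (isDual? f₁ e₁)

e₁f₁-dual : IsDual e₁ f₁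
e₁f₁-dual = from-yes (isDual? e₁ f₁)

f₂ e₂ : Vector B₆ 4
f₂ =
  ( 1ᴮ
  ∷ quat (-[1+ 0 ] / 1) (-[1+ 2 ] / 1) 0ℚ 0ℚ
  ∷ quat -½ (-[1+ 2 ] / 2) -½ -½
  ∷ quat (-[1+ 0 ] / 1) (-[1+ 2 ] / 1) 0ℚ (-[1+ 0 ] / 1)
  ∷ [])
e₂ =
  ( quat ½ (+ 1 / 6) 0ℚ 0ℚ
  ∷ quat 0ℚ (+ 1 / 6) 0ℚ (+ 1 / 6)
  ∷ quat 0ℚ 0ℚ (-[1+ 0 ] / 3) 0ℚ
  ∷ quat 0ℚ 0ℚ (+ 1 / 6) (-[1+ 0 ] / 6)
  ∷ [])

f₂e₂-dual : IsDual f₂ e₂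
f₂e₂-dual = from-yes (isDual? f₂ e₂)

e₂f₂-dual : IsDual e₂ f₂
e₂f₂-dual = from-yes (isDual? e₂ f₂)

f₃ e₃ : Vector B₆ 4
f₃ =
  ( 1ᴮ
  ∷ quat 0ℚ (-[1+ 0 ] / 1) 0ℚ 0ℚ
  ∷ quat 0ℚ (-[1+ 2 ] / 1) 1ℚ (-[1+ 0 ] / 1)
  ∷ quat 0ℚ (-[1+ 2 ] / 1) 1ℚ 0ℚ
  ∷ [])
e₃ =
  ( quat ½ 0ℚ 0ℚ 0ℚ
  ∷ quat 0ℚ ½ -½ 0ℚ
  ∷ quat 0ℚ 0ℚ 0ℚ (-[1+ 0 ] / 6)
  ∷ quat 0ℚ 0ℚ (+ 1 / 6) (+ 1 / 6)
  ∷ [])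

f₃e₃-dual : IsDual f₃ e₃
f₃e₃-dual = from-yes (isDual? f₃ e₃)

e₃f₃-dual : IsDual e₃ f₃
e₃f₃-dual = from-yes (isDual? e₃ f₃)

f₄ e₄ : Vector B₆ 4
f₄ =
  ( 1ᴮ
  ∷ quat 0ℚ (-[1+ 2 ] / 1) 0ℚ 0ℚ
  ∷ quat 0ℚ (-[1+ 2 ] / 1) 1ℚ (-[1+ 0 ] / 1)
  ∷ quat 0ℚ (-[1+ 2 ] / 1) 1ℚ 0ℚ
  ∷ [])
e₄ =
  ( quat ½ 0ℚ 0ℚ 0ℚ
  ∷ quat 0ℚ (+ 1 / 6) (-[1+ 0 ] / 6) 0ℚ
  ∷ quat 0ℚ 0ℚ 0ℚ (-[1+ 0 ] / 6)
  ∷ quat 0ℚ 0ℚ (+ 1 / 6) (+ 1 / 6)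
  ∷ [])

f₄e₄-dual : IsDual f₄ e₄
f₄e₄-dual = from-yes (isDual? f₄ e₄)

e₄f₄-dual : IsDual e₄ f₄
e₄f₄-dual = from-yes (isDual? e₄ f₄)

-- Signatures and decidable checks

diagonal : Vector ℚ 3 → Matℚ.Matrix 3
diagonal d i j with i Fin.≟ j
... | yes _ = d i
... | no  _ = 0ℚ

diagonal-off : ∀ d i j → i ≢ j → diagonal d i j ≡ 0ℚ
diagonal-off d i j i≢j with i Fin.≟ j
... | yes i≡j = ⊥-elim (i≢j i≡j)
... | no  _   = refl

shear : ℚ → ℚ → Matℚ.Matrix 3
shear p q = (1ℚ ∷ 0ℚ ∷ p ∷ []) ∷ (0ℚ ∷ 1ℚ ∷ q ∷ []) ∷ (0ℚ ∷ 0ℚ ∷ 1ℚ ∷ []) ∷ []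

_≋ℚ?_ : (A B : Matℚ.Matrix 3) → Dec (A Matℚ.≋ B)
A ≋ℚ? B = Fin.all? λ i → Fin.all? λ j → A i j ℚ.≟ B i j

_≋ℤ?_ : (A B : Matℤ.Matrix 3) → Dec (A Matℤ.≋ B)
A ≋ℤ? B = Fin.all? λ i → Fin.all? λ j → A i j ℤ.≟ B i j

IsDiagonalisedBy : Matℤ.Matrix 3 → (T S D : Matℚ.Matrix 3) → Set
IsDiagonalisedBy G T S D =
    ((T Matℚ.⊗ S) Matℚ.≋ Matℚ.Id × (S Matℚ.⊗ T) Matℚ.≋ Matℚ.Id)
  × (((T Matℚ.ᵀ) Matℚ.⊗ (λ i j → toℚ (G i j))) Matℚ.⊗ T) Matℚ.≋ D

isDiagonalisedBy? : ∀ G T S D → Dec (IsDiagonalisedBy G T S D)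
isDiagonalisedBy? G T S D =
  ((T Matℚ.⊗ S) ≋ℚ? Matℚ.Id ×-dec (S Matℚ.⊗ T) ≋ℚ? Matℚ.Id)
  ×-dec (((T Matℚ.ᵀ) Matℚ.⊗ (λ i j → toℚ (G i j))) Matℚ.⊗ T) ≋ℚ? D

-- The first two basis vectors of each Gₙ are orthogonal, so a shear of the
-- third one diagonalises it.
hasSignature : ∀ (G : Matℤ.Matrix 3) p q d
  {_ : True (isDiagonalisedBy? G (shear p q) (shear (ℚ.- p) (ℚ.- q)) (diagonal d))} →
  length (filter (λ i → 0ℚ ℚ.<? diagonal d i i) (allFin 3)) ≡ 2 →
  length (filter (λ i → diagonal d i i ℚ.<? 0ℚ) (allFin 3)) ≡ 1 → HasSignature G 2 1
hasSignature G p q d {ok} positive negative =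
  let inverse , TGT = toWitness ok in
  diagonal d , (shear p q , (shear (ℚ.- p) (ℚ.- q) , inverse) , TGT) , diagonal-off d , positive , negative

isometric-refl? : (G : Matℤ.Matrix 3) → Dec _
isometric-refl? G =
  (Matℤ.Id Matℤ.⊗ Matℤ.Id) ≋ℤ? Matℤ.Id ×-dec
  (((Matℤ.Id Matℤ.ᵀ) Matℤ.⊗ G) Matℤ.⊗ Matℤ.Id) ≋ℤ? G

isometric-refl : (G : Matℤ.Matrix 3) {_ : True (isometric-refl? G)} → Matℤ.Isometric G G
isometric-refl G {ok} with toWitness ok
... | II , IGI = Matℤ.Id , (Matℤ.Id , II , II) , IGI

closed? : (f e : Vector B₆ 4) → Dec _
closed? f e = Fin.all? λ i → inSpan? f (products f i) (coefficients e (products f i))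

closed : (f e : Vector B₆ 4) {_ : True (closed? f e)} → ∀ i j → products f i j ∈ span f
closed f e {ok} i j = coefficients e (products f i) j , toWitness ok i j

gram? : (s : ℚ) (e : Vector B₆ 3) (G : Matℤ.Matrix 3) → Dec (∀ i j → bilinear s (e i) (e j) ≡ toℚ (G i j))
gram? s e G = Fin.all? λ i → Fin.all? λ j → bilinear s (e i) (e j) ℚ.≟ toℚ (G i j)

even? : (G : Matℤ.Matrix 3) → Dec (∀ i → + 2 ∣ G i i)
even? G = Fin.all? λ i → + 2 ∣? G i i

-- The order `𝒪⟨6,3⟩` and the even-trace orders

𝒪⟨6,3⟩ : Subset
-- This is ℤ + 3ℤi + ℤj + ℤζ₃: the vector `f₂ 2F` is the conjugate -1 - ζ₃, and ij = 1 + 2ζ₃ - 3i -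
-- j.
𝒪⟨6,3⟩ = span f₂

generators⟨6,1⟩ : Vector B₆ 4
generators⟨6,1⟩ =
  1ᴮ ∷ quat 0ℚ 1ℚ 0ℚ 0ℚ ∷ quat 0ℚ 0ℚ 1ℚ 0ℚ ∷ quat ½ ½ ½ ½ ∷ []

𝒪⟨6,1⟩≐ : 𝒪⟨6,1⟩ ≐ span f₁
𝒪⟨6,1⟩≐ = span-⊆ (span-submodule f₁) (inSpan f₁ generators⟨6,1⟩ (coefficients e₁ generators⟨6,1⟩))
  , span-⊆ (span-submodule generators⟨6,1⟩) (inSpan generators⟨6,1⟩ f₁
      ( (+ 1 ∷ + 0 ∷ + 0 ∷ + 0 ∷ [])
      ∷ (-[1+ 0 ] ∷ -[1+ 0 ] ∷ + 0 ∷ + 0 ∷ [])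
      ∷ (-[1+ 0 ] ∷ -[1+ 0 ] ∷ + 0 ∷ -[1+ 0 ] ∷ [])
      ∷ (-[1+ 1 ] ∷ -[1+ 1 ] ∷ + 1 ∷ -[1+ 1 ] ∷ [])
      ∷ []))

-- The comparison is made on the dual side, between the five generators `scalar ½ ∷ e` and the basis
-- `e′`. Coordinates in `e′` are traces against `g`; five generators of a rank-four lattice have no
-- dual basis, so the other base change `A` is supplied explicitly.
evenTrace≐ : ∀ {O : Subset} (f e g e′ : Vector B₆ 4) → O ≐ span f →
  IsDual f e → IsDual g e′ → (A : Fin 4 → Vector ℤ 5) →
  {_ : True (inSpan? (scalar ½ ∷ e) e′ A)} →
  {_ : True (inSpan? e′ (scalar ½ ∷ e) (coefficients g (scalar ½ ∷ e)))} →
  evenTrace O ≐ span g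
evenTrace≐ {O} f e g e′ O≐ fe ge′ A {ok} {ok′} =
  ≐-trans {Q = IntegralOn (scalar ½ ∷ e)}
    (evenTrace-integralOn e (≐-trans {Q = span f} O≐ (Dual.span≐integralOn f e fe)))
  (≐-trans {Q = IntegralOn e′}
    (integralOn-cong (scalar ½ ∷ e) e′ (inSpan (scalar ½ ∷ e) e′ A {ok})
      (inSpan e′ (scalar ½ ∷ e) (coefficients g (scalar ½ ∷ e)) {ok′}))
    (≐-sym {Q = IntegralOn e′} (Dual.span≐integralOn g e′ ge′)))

evenTrace⟨6,1⟩≐ : evenTrace 𝒪⟨6,1⟩ ≐ span f₃
evenTrace⟨6,1⟩≐ = evenTrace≐ f₁ e₁ f₃ e₃ 𝒪⟨6,1⟩≐ f₁e₁-dual f₃e₃-dual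
  ( (+ 1 ∷ + 0 ∷ + 0 ∷ + 0 ∷ + 0 ∷ [])
  ∷ (+ 0 ∷ + 0 ∷ + 1 ∷ + 3 ∷ + 3 ∷ [])
  ∷ (-[1+ 0 ] ∷ + 1 ∷ -[1+ 0 ] ∷ -[1+ 0 ] ∷ -[1+ 1 ] ∷ [])
  ∷ (+ 0 ∷ + 0 ∷ + 0 ∷ -[1+ 0 ] ∷ -[1+ 0 ] ∷ [])
  ∷ [])

evenTrace⟨6,3⟩≐ : evenTrace 𝒪⟨6,3⟩ ≐ span f₄
evenTrace⟨6,3⟩≐ = evenTrace≐ {𝒪⟨6,3⟩} f₂ e₂ f₄ e₄ (id , id) f₂e₂-dual f₄e₄-dual
  ( (+ 1 ∷ + 0 ∷ + 0 ∷ + 0 ∷ + 0 ∷ [])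
  ∷ (+ 0 ∷ + 0 ∷ + 1 ∷ + 1 ∷ + 1 ∷ [])
  ∷ (-[1+ 0 ] ∷ + 1 ∷ -[1+ 0 ] ∷ + 0 ∷ + 0 ∷ [])
  ∷ (+ 0 ∷ + 0 ∷ + 0 ∷ -[1+ 0 ] ∷ -[1+ 0 ] ∷ [])
  ∷ [])

-- Here and below, the shear completes the square: its parameters are minus the entry (0,2) over the
-- entry (0,0), and minus the entry (1,2) over the entry (1,1). What remains of the third diagonal
-- entry is negative.
signature₁ : HasSignature G₁ 2 1
signature₁ = hasSignature G₁ ½ ½ (+ 6 / 1 ∷ + 4 / 1 ∷ -½ ∷ []) refl refl

signature₂ : HasSignature G₂ 2 1
signature₂ = hasSignature G₂ (+ 3 / 2) ½ (+ 2 / 1 ∷ + 12 / 1 ∷ -[1+ 2 ] / 2 ∷ []) refl refl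

signature₃ : HasSignature G₃ 2 1
signature₃ = hasSignature G₃ ½ 1ℚ (+ 12 / 1 ∷ + 2 / 1 ∷ -[1+ 0 ] / 1 ∷ []) refl refl

signature₄ : HasSignature G₄ 2 1
signature₄ = hasSignature G₄ (+ 3 / 2) 1ℚ (+ 4 / 1 ∷ + 6 / 1 ∷ -[1+ 2 ] / 1 ∷ []) refl refl

module Order₁ = Order {𝒪⟨6,1⟩} f₁ e₁ 𝒪⟨6,1⟩≐ f₁e₁-dual e₁f₁-dual refl

isOrder₁ : IsOrder 𝒪⟨6,1⟩
isOrder₁ = Order₁.isOrder (closed f₁ e₁)

correspondsTo₁ : CorrespondsTo 𝒪⟨6,1⟩ 6 G₁
correspondsTo₁ = Order₁.correspondsTo 6 G₁ refl
  (from-yes (gram? (ℚ.- toℚ (+ 6)) (e₁ ∘ suc) G₁)) (from-yes (even? G₁))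
  signature₁ (isometric-refl G₁)

module Order₂ = Order {𝒪⟨6,3⟩} f₂ e₂ (id , id) f₂e₂-dual e₂f₂-dual refl

isOrder₂ : IsOrder 𝒪⟨6,3⟩
isOrder₂ = Order₂.isOrder (closed f₂ e₂)

correspondsTo₂ : CorrespondsTo 𝒪⟨6,3⟩ 18 G₂
correspondsTo₂ = Order₂.correspondsTo 18 G₂ refl
  (from-yes (gram? (ℚ.- toℚ (+ 18)) (e₂ ∘ suc) G₂)) (from-yes (even? G₂))
  signature₂ (isometric-refl G₂)

module Order₃ = Order {evenTrace 𝒪⟨6,1⟩} f₃ e₃ evenTrace⟨6,1⟩≐ f₃e₃-dual e₃f₃-dual refl

isOrder₃ : IsOrder (evenTrace 𝒪⟨6,1⟩)
isOrder₃ = Order₃.isOrder (closed f₃ e₃)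

correspondsTo₃ : CorrespondsTo (evenTrace 𝒪⟨6,1⟩) 12 G₃
correspondsTo₃ = Order₃.correspondsTo 12 G₃ refl
  (from-yes (gram? (ℚ.- toℚ (+ 12)) (e₃ ∘ suc) G₃)) (from-yes (even? G₃))
  signature₃ (isometric-refl G₃)

module Order₄ = Order {evenTrace 𝒪⟨6,3⟩} f₄ e₄ evenTrace⟨6,3⟩≐ f₄e₄-dual e₄f₄-dual refl

isOrder₄ : IsOrder (evenTrace 𝒪⟨6,3⟩)
isOrder₄ = Order₄.isOrder (closed f₄ e₄)

correspondsTo₄ : CorrespondsTo (evenTrace 𝒪⟨6,3⟩) 36 G₄
correspondsTo₄ = Order₄.correspondsTo 36 G₄ refl
  (from-yes (gram? (ℚ.- toℚ (+ 36)) (e₄ ∘ suc) G₄)) (from-yes (even? G₄))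
  signature₄ (isometric-refl G₄)

-- Maximality

↧*p≡↥ : ∀ p → toℚ (↧ p) ℚ.* p ≡ toℚ (↥ p)
↧*p≡↥ p@record{} = ℚ.toℚᵘ-injective (begin
  ℚ.toℚᵘ (toℚ (↧ p) ℚ.* p)             ≈⟨ ℚ.toℚᵘ-homo-* (toℚ (↧ p)) p ⟩
  ℚ.toℚᵘ (toℚ (↧ p)) ℚᵘ.* ℚ.toℚᵘ p     ≈⟨ ℚᵘ.*-congʳ (toℚᵘ-toℚ (↧ p)) ⟩
  mkℚᵘ (↧ p) 0 ℚᵘ.* ℚ.toℚᵘ p           ≈⟨ *≡* (cross (↥ p) (↧ p)) ⟩
  mkℚᵘ (↥ p) 0                         ≈⟨ toℚᵘ-toℚ (↥ p) ⟨
  ℚ.toℚᵘ (toℚ (↥ p))                   ∎)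
  where
  open ℚᵘ.≃-Reasoning
  cross : ∀ n d → d ℤ.* n ℤ.* + 1 ≡ n ℤ.* (+ 1 ℤ.* d)
  cross = solve 2 (λ n d → d :* n :* con (+ 1) := n :* (con (+ 1) :* d)) refl
    where open ℤ-Solver

-- The base b = 2 + d divides every term, and dividing the whole sequence by b
-- gives a sequence of the same kind with a smaller first term.
geometric≡0 : ∀ N d → Coprime ℤ.∣ N ∣ (2 ℕ.+ d) → (z : ℕ → ℤ) →
  (∀ n → z (suc n) ℤ.* + (2 ℕ.+ d) ≡ z n ℤ.* N) → z 0 ≡ + 0
geometric≡0 N d coprime z rec = descend ℤ.∣ z 0 ∣ z rec ℕ.≤-refl
  where
  b = + (2 ℕ.+ d)

  descend : ∀ B z → (∀ n → z (suc n) ℤ.* b ≡ z n ℤ.* N) → ℤ.∣ z 0 ∣ ℕ.≤ B → z 0 ≡ + 0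
  descend zero    z rec z₀≤B = ℤ.∣i∣≡0⇒i≡0 (ℕ.n≤0⇒n≡0 z₀≤B)
  descend (suc B) z rec z₀≤B = begin
    z 0            ≡⟨ z≡w*b 0 ⟩
    w 0 ℤ.* b      ≡⟨ cong (ℤ._* b) (descend B w rec′ w₀≤B) ⟩
    + 0            ∎
    where
    open ≡-Reasoning
    b∣z : ∀ n → b ∣ z n
    -- z (n + 1) b = z n N shows that b divides N z n, and b is coprime to N.
    b∣z n = ∣ᵤ⇒∣ (coprime-divisor b N (z n) (Coprime.sym coprime)
      (∣⇒∣ᵤ {b} {N ℤ.* z n} (divides (z (suc n)) (trans (ℤ.*-comm N (z n)) (sym (rec n))))))
    w : ℕ → ℤ
    w n = _∣_.quotient (b∣z n)
    z≡w*b : ∀ n → z n ≡ w n ℤ.* b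
    z≡w*b n = _∣_.equality (b∣z n)
    rec′ : ∀ n → w (suc n) ℤ.* b ≡ w n ℤ.* N
    rec′ n = ℤ.*-cancelʳ-≡ (w (suc n) ℤ.* b) (w n ℤ.* N) b (begin
      w (suc n) ℤ.* b ℤ.* b   ≡⟨ cong (ℤ._* b) (z≡w*b (suc n)) ⟨
      z (suc n) ℤ.* b         ≡⟨ rec n ⟩
      z n ℤ.* N               ≡⟨ cong (ℤ._* N) (z≡w*b n) ⟩
      w n ℤ.* b ℤ.* N         ≡⟨ swap (w n) b N ⟩
      w n ℤ.* N ℤ.* b         ∎)
      where
      swap : ∀ x y z → x ℤ.* y ℤ.* z ≡ x ℤ.* z ℤ.* y
      swap = solve 3 (λ x y z → x :* y :* z := x :* z :* y) refl
        where open ℤ-Solver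
    ∣z₀∣≡ : ℤ.∣ z 0 ∣ ≡ ℤ.∣ w 0 ∣ ℕ.* (2 ℕ.+ d)
    ∣z₀∣≡ = trans (cong ℤ.∣_∣ (z≡w*b 0)) (ℤ.abs-* (w 0) b)
    -- As b is at least 2, division by b strictly lowers a positive absolute value, so the bound
    -- drops from `suc B` to `B`.
    shrink : ∀ m → m ℕ.* (2 ℕ.+ d) ℕ.≤ suc B → m ℕ.≤ B
    shrink zero    _  = ℕ.z≤n
    shrink (suc m) le = ℕ.s≤s⁻¹ (ℕ.≤-trans (ℕ.m<m*n (suc m) (2 ℕ.+ d) (ℕ.s≤s (ℕ.s≤s ℕ.z≤n))) le)
    w₀≤B : ℤ.∣ w 0 ∣ ℕ.≤ B
    w₀≤B = shrink ℤ.∣ w 0 ∣ (subst (ℕ._≤ suc B) ∣z₀∣≡ z₀≤B)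

_^ℚ_ : ℚ → ℕ → ℚ
q ^ℚ zero  = 1ℚ
q ^ℚ suc n = q ℚ.* q ^ℚ n

-- `mkℚ` stores the denominator minus one, so the first case is denominator 1. Otherwise let q = N /
-- b in lowest terms: the integers z n = D qⁿ satisfy z (n + 1) b = z n N, and `geometric≡0` forces
-- D = z 0 = 0.
integer-from-powers : ∀ q D → D ≢ + 0 → (∀ n → Integer (toℚ D ℚ.* q ^ℚ n)) → Integer q
integer-from-powers q@(mkℚ N zero _) D D≢0 powers =
  N , trans (sym (ℚ.*-identityˡ q)) (↧*p≡↥ q)
integer-from-powers q@(mkℚ N (suc d) coprime) D D≢0 powers =
  ⊥-elim (D≢0 (trans D≡z₀ (geometric≡0 N d (Coprime.recompute coprime) z rec)))
  where
  open ≡-Reasoning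
  z : ℕ → ℤ
  z n = proj₁ (powers n)
  D≡z₀ : D ≡ z 0
  D≡z₀ = toℚ-injective (trans (sym (ℚ.*-identityʳ (toℚ D))) (proj₂ (powers 0)))
  regroup : ∀ D q p d → D ℚ.* (q ℚ.* p) ℚ.* d ≡ D ℚ.* p ℚ.* (d ℚ.* q)
  regroup = solve 4 (λ D q p d → D :* (q :* p) :* d := D :* p :* (d :* q)) refl
    where open ℚ-Solver
  rec : ∀ n → z (suc n) ℤ.* ↧ q ≡ z n ℤ.* N
  rec n = toℚ-injective (begin
    toℚ (z (suc n) ℤ.* ↧ q)                       ≡⟨ toℚ-* (z (suc n)) (↧ q) ⟩
    toℚ (z (suc n)) ℚ.* toℚ (↧ q)                 ≡⟨ cong (ℚ._* toℚ (↧ q)) (proj₂ (powers (suc n))) ⟨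
    toℚ D ℚ.* (q ℚ.* q ^ℚ n) ℚ.* toℚ (↧ q)        ≡⟨ regroup (toℚ D) q (q ^ℚ n) (toℚ (↧ q)) ⟩
    toℚ D ℚ.* q ^ℚ n ℚ.* (toℚ (↧ q) ℚ.* q)        ≡⟨ cong₂ ℚ._*_ (proj₂ (powers n)) (↧*p≡↥ q) ⟩
    toℚ (z n) ℚ.* toℚ N                           ≡⟨ toℚ-* (z n) N ⟨
    toℚ (z n ℤ.* N)                               ∎)

-- The norm form in terms of traces

traceForm : (α β γ δ : ℚ) → ℚ
traceForm α β γ δ = toℚ (+ 3) ℚ.* (α ℚ.* α ℚ.+ β ℚ.* β) ℚ.+ toℚ -[1+ 0 ] ℚ.* (γ ℚ.* γ ℚ.+ δ ℚ.* δ)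

traceFormℤ : (α β γ δ : ℤ) → ℤ
traceFormℤ α β γ δ = + 3 ℤ.* (α ℤ.* α ℤ.+ β ℤ.* β) ℤ.+ -[1+ 0 ] ℤ.* (γ ℤ.* γ ℤ.+ δ ℤ.* δ)

toℚ-traceForm : ∀ α β γ δ → toℚ (traceFormℤ α β γ δ) ≡ traceForm (toℚ α) (toℚ β) (toℚ γ) (toℚ δ)
toℚ-traceForm α β γ δ = begin
  toℚ (traceFormℤ α β γ δ)
    ≡⟨ toℚ-+ (+ 3 ℤ.* (α ℤ.* α ℤ.+ β ℤ.* β)) (-[1+ 0 ] ℤ.* (γ ℤ.* γ ℤ.+ δ ℤ.* δ)) ⟩
  toℚ (+ 3 ℤ.* (α ℤ.* α ℤ.+ β ℤ.* β)) ℚ.+ toℚ (-[1+ 0 ] ℤ.* (γ ℤ.* γ ℤ.+ δ ℤ.* δ))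
    ≡⟨ cong₂ ℚ._+_ (toℚ-scaled-squares (+ 3) α β) (toℚ-scaled-squares -[1+ 0 ] γ δ) ⟩
  traceForm (toℚ α) (toℚ β) (toℚ γ) (toℚ δ) ∎
  where
  open ≡-Reasoning
  toℚ-scaled-squares : ∀ m y z →
    toℚ (m ℤ.* (y ℤ.* y ℤ.+ z ℤ.* z)) ≡ toℚ m ℚ.* (toℚ y ℚ.* toℚ y ℚ.+ toℚ z ℚ.* toℚ z)
  toℚ-scaled-squares m y z = begin
    toℚ (m ℤ.* (y ℤ.* y ℤ.+ z ℤ.* z))           ≡⟨ toℚ-* m (y ℤ.* y ℤ.+ z ℤ.* z) ⟩
    toℚ m ℚ.* toℚ (y ℤ.* y ℤ.+ z ℤ.* z)         ≡⟨ cong (toℚ m ℚ.*_) (toℚ-+ (y ℤ.* y) (z ℤ.* z)) ⟩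
    toℚ m ℚ.* (toℚ (y ℤ.* y) ℚ.+ toℚ (z ℤ.* z)) ≡⟨ cong (toℚ m ℚ.*_) (cong₂ ℚ._+_ (toℚ-* y y) (toℚ-* z z)) ⟩
    toℚ m ℚ.* (toℚ y ℚ.* toℚ y ℚ.+ toℚ z ℚ.* toℚ z) ∎

module _ where
  open ℚ-Solver
  open Symbolic {4}

  private
    x·_ : (std-e : Poly) → (t x y z : Polynomial 4) → Polynomial 4
    (x· e) t x y z = trdᴾ (mulᴾ (con (ℚ.- 1ℚ)) (con (+ 3 / 1)) (quatᴾ t x y z) e)

    quatᶜ : (t x y z : ℚ) → Poly
    quatᶜ t x y z = quatᴾ (con t) (con x) (con y) (con z)

    s₀ s₁ s₂ s₃ : Poly
    s₀ = quatᶜ 1ℚ 0ℚ 0ℚ 0ℚ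
    s₁ = quatᶜ 0ℚ 1ℚ 0ℚ 0ℚ
    s₂ = quatᶜ 0ℚ 0ℚ 1ℚ 0ℚ
    s₃ = quatᶜ 0ℚ 0ℚ 0ℚ 1ℚ

  -- For x = t + ui + vj + w ij the four traces are 2t, -2u, 6v, 6w, while nrd x = t² + u² - 3v² -
  -- 3w².
  nrd-from-traces : ∀ (x : B₆) → toℚ (+ 12) ℚ.* nrd x ≡
    traceForm (trd (x *ᴮ std 0F)) (trd (x *ᴮ std 1F)) (trd (x *ᴮ std 2F)) (trd (x *ᴮ std 3F))
  nrd-from-traces (quat t x y z) = solve 4 (λ t x y z →
    let A₀ = (x· s₀) t x y z; A₁ = (x· s₁) t x y z; A₂ = (x· s₂) t x y z; A₃ = (x· s₃) t x y z in
    con (toℚ (+ 12)) :* nrdᴾ (con (ℚ.- 1ℚ)) (con (+ 3 / 1)) (quatᴾ t x y z)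
      := con (toℚ (+ 3)) :* (A₀ :* A₀ :+ A₁ :* A₁) :+ con (toℚ -[1+ 0 ]) :* (A₂ :* A₂ :+ A₃ :* A₃))
    refl t x y z

  -- This and the next three identities turn integrality against `e₁` into divisibility conditions
  -- on the four traces against `std`.
  trd-e₁₀ : ∀ (x : B₆) → trd (x *ᴮ e₁ 0F) ≡ ½ ℚ.* (trd (x *ᴮ std 0F) ℚ.+ trd (x *ᴮ std 1F))
  trd-e₁₀ (quat t x y z) = solve 4 (λ t x y z →
    (x· quatᶜ ½ ½ 0ℚ 0ℚ) t x y z := con ½ :* ((x· s₀) t x y z :+ (x· s₁) t x y z)) refl t x y z

  trd-e₁₁ : ∀ (x : B₆) → trd (x *ᴮ e₁ 1F) ≡ ½ ℚ.* (trd (x *ᴮ std 1F) ℚ.+ trd (x *ᴮ std 3F))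
  trd-e₁₁ (quat t x y z) = solve 4 (λ t x y z →
    (x· quatᶜ 0ℚ ½ 0ℚ ½) t x y z := con ½ :* ((x· s₁) t x y z :+ (x· s₃) t x y z)) refl t x y z

  trd-e₁₂ : ∀ (x : B₆) → trd (x *ᴮ e₁ 2F) ≡ (-[1+ 0 ] / 3) ℚ.* trd (x *ᴮ std 2F)
  trd-e₁₂ (quat t x y z) = solve 4 (λ t x y z →
    (x· quatᶜ 0ℚ 0ℚ (-[1+ 0 ] / 3) 0ℚ) t x y z := con (-[1+ 0 ] / 3) :* (x· s₂) t x y z) refl t x y z

  trd-e₁₃ : ∀ (x : B₆) → trd (x *ᴮ e₁ 3F) ≡ (+ 1 / 6) ℚ.* (trd (x *ᴮ std 2F) ℚ.+ toℚ -[1+ 0 ] ℚ.* trd (x *ᴮ std 3F))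
  trd-e₁₃ (quat t x y z) = solve 4 (λ t x y z →
    (x· quatᶜ 0ℚ 0ℚ (+ 1 / 6) (-[1+ 0 ] / 6)) t x y z
      := con (+ 1 / 6) :* ((x· s₂) t x y z :+ con (toℚ -[1+ 0 ]) :* (x· s₃) t x y z)) refl t x y z

12nrd≡traceForm : ∀ x (A : IntegralOn std x) → toℚ (+ 12) ℚ.* nrd x ≡
  toℚ (traceFormℤ (proj₁ (A 0F)) (proj₁ (A 1F)) (proj₁ (A 2F)) (proj₁ (A 3F)))
12nrd≡traceForm x A = trans (nrd-from-traces x) (trans
  (traceForm-cong (proj₂ (A 0F)) (proj₂ (A 1F)) (proj₂ (A 2F)) (proj₂ (A 3F)))
  (sym (toℚ-traceForm (proj₁ (A 0F)) (proj₁ (A 1F)) (proj₁ (A 2F)) (proj₁ (A 3F)))))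
  where
  traceForm-cong : ∀ {α β γ δ α′ β′ γ′ δ′} → α ≡ α′ → β ≡ β′ → γ ≡ γ′ → δ ≡ δ′ →
    traceForm α β γ δ ≡ traceForm α′ β′ γ′ δ′
  traceForm-cong refl refl refl refl = refl

12nrd-integer : ∀ x → IntegralOn std x → Integer (toℚ (+ 12) ℚ.* nrd x)
12nrd-integer x A = traceFormℤ (proj₁ (A 0F)) (proj₁ (A 1F)) (proj₁ (A 2F)) (proj₁ (A 3F)) , 12nrd≡traceForm x A

-- Each trace has its own denominator, and integrality survives passing to a multiple of D, so
-- finitely many denominators can be multiplied together. `common-multiple` is applied over `std`
-- for a single vector, then over the vectors of `e`.
common-denominator : ∀ {n} (e : Vector B₆ n) →
  ∃[ D ] D ≢ + 0 × ∀ k → IntegralOn std (toℚ D · e k)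
common-denominator e = common-multiple (λ k D → IntegralOn std (toℚ D · e k))
  (λ k m D ok → subst (IntegralOn std) (sym (·-assoc m D (e k)))
    (integralOn-submodule std .·-closed m {toℚ D · e k} ok))
  (λ k → clear (e k))
  where
  common-multiple : ∀ {n} (Q : Fin n → ℤ → Set) → (∀ k m D → Q k D → Q k (m ℤ.* D)) →
    (∀ k → ∃[ D ] D ≢ + 0 × Q k D) → ∃[ D ] D ≢ + 0 × ∀ k → Q k D
  common-multiple {zero} Q multiple each = + 1 , (λ ()) , λ ()
  common-multiple {suc n} Q multiple each
    with each zero | common-multiple (Q ∘ suc) (multiple ∘ suc) (each ∘ suc)
  ... | D , D≢0 , QD | E , E≢0 , QE = E ℤ.* D , ED≢0 , λ
    { zero → multiple zero E D QD
    ; (suc k) → subst (Q (suc k)) (ℤ.*-comm D E) (multiple (suc k) D E (QE k)) }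
    where
    ED≢0 : E ℤ.* D ≢ + 0
    ED≢0 ED≡0 with ℤ.i*j≡0⇒i≡0∨j≡0 E ED≡0
    ... | inj₁ E≡0 = E≢0 E≡0
    ... | inj₂ D≡0 = D≢0 D≡0

  ·-assoc : ∀ m D (x : B₆) → toℚ (m ℤ.* D) · x ≡ toℚ m · (toℚ D · x)
  ·-assoc m D x = begin
    toℚ (m ℤ.* D) · x                   ≡⟨ cong (_· x) (toℚ-* m D) ⟩
    (toℚ m ℚ.* toℚ D) · x               ≡⟨ quat-≡ (ℚ.*-assoc (toℚ m) (toℚ D) _) (ℚ.*-assoc (toℚ m) (toℚ D) _)
                                             (ℚ.*-assoc (toℚ m) (toℚ D) _) (ℚ.*-assoc (toℚ m) (toℚ D) _) ⟩
    toℚ m · (toℚ D · x)                 ∎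
    where open ≡-Reasoning

  clear : ∀ x → ∃[ D ] D ≢ + 0 × IntegralOn std (toℚ D · x)
  clear x = common-multiple (λ k D → Integer (trd ((toℚ D · x) *ᴮ std k)))
    (λ k m D ok → subst (λ y → Integer (trd (y *ᴮ std k))) (sym (·-assoc m D x))
      (integer-trd-*ʳ-submodule (std k) .·-closed m {toℚ D · x} ok))
    (λ k → ↧ trd (x *ᴮ std k) , (λ ()) , ↥ trd (x *ᴮ std k) , (begin
      trd ((toℚ (↧ trd (x *ᴮ std k)) · x) *ᴮ std k)
        ≡⟨ cong trd (·-*ᴮ-assoc (toℚ (↧ trd (x *ᴮ std k))) x (std k)) ⟩
      trd (toℚ (↧ trd (x *ᴮ std k)) · (x *ᴮ std k))   ≡⟨ trd-· (toℚ (↧ trd (x *ᴮ std k))) (x *ᴮ std k) ⟩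
      toℚ (↧ trd (x *ᴮ std k)) ℚ.* trd (x *ᴮ std k)   ≡⟨ ↧*p≡↥ (trd (x *ᴮ std k)) ⟩
      toℚ (↥ trd (x *ᴮ std k))                        ∎))
    where open ≡-Reasoning

·-linear : ∀ p → IsLinear (p ·_)
·-linear p .+-homo x y = quat-≡
  (ℚ.*-distribˡ-+ p _ _) (ℚ.*-distribˡ-+ p _ _) (ℚ.*-distribˡ-+ p _ _) (ℚ.*-distribˡ-+ p _ _)
·-linear p .·-homo q x = quat-≡ (swap p q (re x)) (swap p q (im-i x)) (swap p q (im-j x)) (swap p q (im-ij x))
  where
  swap : ∀ p q t → p ℚ.* (q ℚ.* t) ≡ q ℚ.* (p ℚ.* t)
  swap = solve 3 (λ p q t → p :* (q :* t) := q :* (p :* t)) refl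
    where open ℚ-Solver

-- Integrality of norms and traces in an order

module _ {O : Subset} (order : IsOrder O) where
  open IsOrder order

  private
    e = proj₁ lattice
    open IsBasis (proj₂ lattice) using (spanning)

    _^_ : B₆ → ℕ → B₆
    x ^ zero  = 1ᴮ
    x ^ suc n = x *ᴮ x ^ n

    ^-closed : ∀ {x} → x ∈ O → ∀ n → x ^ n ∈ O
    ^-closed x∈ zero    = one
    ^-closed x∈ (suc n) = *-closed x∈ (^-closed x∈ n)

    nrd-^ : ∀ x n → nrd (x ^ n) ≡ nrd x ^ℚ n
    nrd-^ x zero    = refl
    nrd-^ x (suc n) = trans (nrd-*ᴮ x (x ^ n)) (cong (nrd x ℚ.*_) (nrd-^ x n))

  order-submodule : IsSubmodule O
  order-submodule = ≐-submodule spanning (span-submodule e)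

  private
    -- All powers of x lie in O and D clears the traces of O, so 12 D² (nrd x)ⁿ = 12 nrd (D xⁿ) is
    -- an integer for every n.
    integer-nrd-given : ∀ D → D ≢ + 0 → (∀ k → IntegralOn std (toℚ D · e k)) → ∀ x → x ∈ O → Integer (nrd x)
    integer-nrd-given D D≢0 clears x x∈O = integer-from-powers (nrd x) (+ 12 ℤ.* (D ℤ.* D)) 12DD≢0 scaled-power
      where
      open ≡-Reasoning
      12DD≢0 : + 12 ℤ.* (D ℤ.* D) ≢ + 0
      12DD≢0 eq with ℤ.i*j≡0⇒i≡0∨j≡0 (+ 12) eq
      ... | inj₂ DD≡0 with ℤ.i*j≡0⇒i≡0∨j≡0 D DD≡0
      ...   | inj₁ D≡0 = D≢0 D≡0
      ...   | inj₂ D≡0 = D≢0 D≡0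
      cleared : ∀ y → y ∈ O → IntegralOn std (toℚ D · y)
      cleared y y∈O = span-⊆ {P = λ z → IntegralOn std (toℚ D · z)}
        (preimage-submodule (·-linear (toℚ D)) (integralOn-submodule std)) clears {y} (proj₁ spanning y∈O)
      scaled-power : ∀ n → Integer (toℚ (+ 12 ℤ.* (D ℤ.* D)) ℚ.* nrd x ^ℚ n)
      scaled-power n = let m , 12nrd≡m = 12nrd-integer (toℚ D · x ^ n) (cleared (x ^ n) (^-closed x∈O n)) in m , (begin
        toℚ (+ 12 ℤ.* (D ℤ.* D)) ℚ.* nrd x ^ℚ n
          ≡⟨ cong₂ ℚ._*_ (trans (toℚ-* (+ 12) (D ℤ.* D)) (cong (toℚ (+ 12) ℚ.*_) (toℚ-* D D))) (sym (nrd-^ x n)) ⟩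
        toℚ (+ 12) ℚ.* (toℚ D ℚ.* toℚ D) ℚ.* nrd (x ^ n)
          ≡⟨ ℚ.*-assoc (toℚ (+ 12)) (toℚ D ℚ.* toℚ D) (nrd (x ^ n)) ⟩
        toℚ (+ 12) ℚ.* (toℚ D ℚ.* toℚ D ℚ.* nrd (x ^ n))
          ≡⟨ cong (toℚ (+ 12) ℚ.*_) (nrd-· (toℚ D) (x ^ n)) ⟨
        toℚ (+ 12) ℚ.* nrd (toℚ D · x ^ n)
          ≡⟨ 12nrd≡m ⟩
        toℚ m ∎)

  integer-nrd : ∀ x → x ∈ O → Integer (nrd x)
  integer-nrd = let D , D≢0 , clears = common-denominator e in integer-nrd-given D D≢0 clears

  integer-trd : ∀ x → x ∈ O → Integer (trd x)
  integer-trd x x∈O = subst Integer (sym (trd-via-nrd x))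
    (integer-+ {nrd (1ᴮ +ᴮ x)} (integer-nrd (1ᴮ +ᴮ x) (order-submodule .+-closed {1ᴮ} {x} one x∈O))
      (integer-* {ℚ.- 1ℚ} {nrd x ℚ.+ 1ℚ} (-[1+ 0 ] , refl) (integer-+ {nrd x} {1ℚ} (integer-nrd x x∈O) (+ 1 , refl))))

-- Congruences modulo 3 and modulo 4

residue : ∀ d .{{_ : ℕ.NonZero d}} (n : ℤ) → ∃[ r ] ∃[ q ] n ≡ + toℕ {d} r ℤ.+ q ℤ.* + d
residue d n = fromℕ< (n%ℕd<d n d) , n ℤ./ℕ d , (begin
  n ≡⟨ a≡a%ℕn+[a/ℕn]*n n d ⟩
  + (n ℤ.%ℕ d) ℤ.+ (n ℤ./ℕ d) ℤ.* + d
    ≡⟨ cong (λ r → + r ℤ.+ (n ℤ./ℕ d) ℤ.* + d) (Fin.toℕ-fromℕ< (n%ℕd<d n d)) ⟨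
  + toℕ (fromℕ< (n%ℕd<d n d)) ℤ.+ (n ℤ./ℕ d) ℤ.* + d ∎)
  where open ≡-Reasoning

-- -1 is not a square modulo 3.
3∣m²+n² : ∀ m n → + 3 ∣ m ℤ.* m ℤ.+ n ℤ.* n → + 3 ∣ m × + 3 ∣ n
3∣m²+n² m n 3∣ with residue 3 m | residue 3 n
... | r , q , refl | s , t , refl =
  let 3∣r , 3∣s = residues r s (∣m+n∣n⇒∣m
        (subst (+ 3 ∣_) (expand² (+ toℕ r) (+ toℕ s) q t) 3∣) (∣m⇒∣m*n _ (divides (+ 1) refl)))
  in ∣m∣n⇒∣m+n 3∣r (divides q refl) , ∣m∣n⇒∣m+n 3∣s (divides t refl)
  where
  residues : ∀ (r s : Fin 3) → + 3 ∣ + toℕ r ℤ.* + toℕ r ℤ.+ + toℕ s ℤ.* + toℕ s →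
    + 3 ∣ + toℕ r × + 3 ∣ + toℕ s
  residues = from-yes (Fin.all? λ (r : Fin 3) → Fin.all? λ (s : Fin 3) →
    (+ 3 ∣? + toℕ r ℤ.* + toℕ r ℤ.+ + toℕ s ℤ.* + toℕ s) →-dec ((+ 3 ∣? + toℕ r) ×-dec (+ 3 ∣? + toℕ s)))
  expand² : ∀ r s q t → (r ℤ.+ q ℤ.* + 3) ℤ.* (r ℤ.+ q ℤ.* + 3) ℤ.+ (s ℤ.+ t ℤ.* + 3) ℤ.* (s ℤ.+ t ℤ.* + 3)
    ≡ (r ℤ.* r ℤ.+ s ℤ.* s) ℤ.+ + 3 ℤ.* (q ℤ.* (r ℤ.+ r ℤ.+ q ℤ.* + 3) ℤ.+ t ℤ.* (s ℤ.+ s ℤ.+ t ℤ.* + 3))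
  expand² = solve 4 (λ r s q t →
    (r :+ q :* con (+ 3)) :* (r :+ q :* con (+ 3)) :+ (s :+ t :* con (+ 3)) :* (s :+ t :* con (+ 3))
      := (r :* r :+ s :* s) :+ con (+ 3) :* (q :* (r :+ r :+ q :* con (+ 3)) :+ t :* (s :+ s :+ t :* con (+ 3)))) refl
    where open ℤ-Solver

sum-of-squares : (a b c d : ℤ) → ℤ
sum-of-squares a b c d = (a ℤ.* a ℤ.+ b ℤ.* b) ℤ.+ (c ℤ.* c ℤ.+ d ℤ.* d)

-- A square is 0 or 1 modulo 4 according to parity, so the four numbers are all even or all odd.
-- Since (r + 2q)² and r² agree modulo 4, the sixteen parity patterns suffice.
4∣sum-of-squares : ∀ a b c d → + 4 ∣ sum-of-squares a b c d →
  + 2 ∣ a ℤ.+ b × + 2 ∣ b ℤ.+ d × + 2 ∣ c ℤ.+ d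
4∣sum-of-squares a b c d 4∣ with residue 2 a | residue 2 b | residue 2 c | residue 2 d
... | i , a′ , refl | j , b′ , refl | k , c′ , refl | l , d′ , refl =
  let 2∣i+j , 2∣j+l , 2∣k+l = residues i j k l (∣m+n∣n⇒∣m
        (subst (+ 4 ∣_) (expand² (+ toℕ i) (+ toℕ j) (+ toℕ k) (+ toℕ l) a′ b′ c′ d′) 4∣) (∣m⇒∣m*n _ (divides (+ 1) refl)))
  in lift i j a′ b′ 2∣i+j , lift j l b′ d′ 2∣j+l , lift k l c′ d′ 2∣k+l
  where
  residues : ∀ (i j k l : Fin 2) → + 4 ∣ sum-of-squares (+ toℕ i) (+ toℕ j) (+ toℕ k) (+ toℕ l) →
    + 2 ∣ + toℕ i ℤ.+ + toℕ j × + 2 ∣ + toℕ j ℤ.+ + toℕ l × + 2 ∣ + toℕ k ℤ.+ + toℕ l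
  residues = from-yes (Fin.all? λ (i : Fin 2) → Fin.all? λ (j : Fin 2) →
    Fin.all? λ (k : Fin 2) → Fin.all? λ (l : Fin 2) →
    (+ 4 ∣? sum-of-squares (+ toℕ i) (+ toℕ j) (+ toℕ k) (+ toℕ l)) →-dec
    ((+ 2 ∣? + toℕ i ℤ.+ + toℕ j) ×-dec (+ 2 ∣? + toℕ j ℤ.+ + toℕ l) ×-dec (+ 2 ∣? + toℕ k ℤ.+ + toℕ l)))
  open ℤ-Solver
  expand² : ∀ i j k l a b c d →
    sum-of-squares (i ℤ.+ a ℤ.* + 2) (j ℤ.+ b ℤ.* + 2) (k ℤ.+ c ℤ.* + 2) (l ℤ.+ d ℤ.* + 2) ≡
    sum-of-squares i j k l ℤ.+
      + 4 ℤ.* ((a ℤ.* (i ℤ.+ a) ℤ.+ b ℤ.* (j ℤ.+ b)) ℤ.+ (c ℤ.* (k ℤ.+ c) ℤ.+ d ℤ.* (l ℤ.+ d)))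
  expand² = solve 8 (λ i j k l a b c d →
    let ² = λ m → m :* m; lift = λ r q → ² (r :+ q :* con (+ 2)) in
    (lift i a :+ lift j b) :+ (lift k c :+ lift l d) :=
    ((² i :+ ² j) :+ (² k :+ ² l)) :+
      con (+ 4) :* ((a :* (i :+ a) :+ b :* (j :+ b)) :+ (c :* (k :+ c) :+ d :* (l :+ d)))) refl
  lift : ∀ (i j : Fin 2) a b → + 2 ∣ + toℕ i ℤ.+ + toℕ j →
    + 2 ∣ (+ toℕ i ℤ.+ a ℤ.* + 2) ℤ.+ (+ toℕ j ℤ.+ b ℤ.* + 2)
  lift i j a b 2∣ = subst (+ 2 ∣_)
    (solve 4 (λ i j a b → (i :+ j) :+ (a :+ b) :* con (+ 2) := (i :+ a :* con (+ 2)) :+ (j :+ b :* con (+ 2)))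
      refl (+ toℕ i) (+ toℕ j) a b)
    (∣m∣n⇒∣m+n 2∣ (divides (a ℤ.+ b) refl))

-- Integrality against `e₁` with denominators cleared: 2, 2, -3, 6 are the inverses of the factors
-- ½, ½, -1/3, 1/6 in `trd-e₁₀` to `trd-e₁₃`.
TraceCongruences : (α β γ δ : ℤ) → Set
TraceCongruences α β γ δ =
    (∃[ p ] α ℤ.+ β ≡ + 2 ℤ.* p) × (∃[ q ] β ℤ.+ δ ≡ + 2 ℤ.* q)
  × (∃[ r ] γ ≡ -[1+ 2 ] ℤ.* r) × (∃[ s ] γ ℤ.+ -[1+ 0 ] ℤ.* δ ≡ + 6 ℤ.* s)

-- Modulo 3 the equation says γ² + δ² ≡ 0, so γ = 3g and δ = 3h. Dividing by 3 leaves α² + β² - 3(g²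
-- + h²) = 4ν, and adding 4(g² + h²) gives a sum of four squares divisible by 4.
trace-congruences : ∀ α β γ δ ν → traceFormℤ α β γ δ ≡ + 12 ℤ.* ν → TraceCongruences α β γ δ
trace-congruences α β γ δ ν form≡12ν = modulo-3
  (3∣m²+n² γ δ (divides (α ℤ.* α ℤ.+ β ℤ.* β ℤ.+ -[1+ 3 ] ℤ.* ν) γ²+δ²≡)) form≡12ν
  where
  open ≡-Reasoning
  open ℤ-Solver
  γ²+δ²≡ : γ ℤ.* γ ℤ.+ δ ℤ.* δ ≡ (α ℤ.* α ℤ.+ β ℤ.* β ℤ.+ -[1+ 3 ] ℤ.* ν) ℤ.* + 3
  γ²+δ²≡ = begin
    γ ℤ.* γ ℤ.+ δ ℤ.* δ
      ≡⟨ solve 4 (λ α β γ δ → γ :* γ :+ δ :* δ := con (+ 3) :* (α :* α :+ β :* β) :+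
           con -[1+ 0 ] :* (con (+ 3) :* (α :* α :+ β :* β) :+ con -[1+ 0 ] :* (γ :* γ :+ δ :* δ))) refl α β γ δ ⟩
    + 3 ℤ.* (α ℤ.* α ℤ.+ β ℤ.* β) ℤ.+ -[1+ 0 ] ℤ.* traceFormℤ α β γ δ
      ≡⟨ cong (λ f → + 3 ℤ.* (α ℤ.* α ℤ.+ β ℤ.* β) ℤ.+ -[1+ 0 ] ℤ.* f) form≡12ν ⟩
    + 3 ℤ.* (α ℤ.* α ℤ.+ β ℤ.* β) ℤ.+ -[1+ 0 ] ℤ.* (+ 12 ℤ.* ν)
      ≡⟨ solve 3 (λ α β ν → con (+ 3) :* (α :* α :+ β :* β) :+ con -[1+ 0 ] :* (con (+ 12) :* ν)
           := (α :* α :+ β :* β :+ con -[1+ 3 ] :* ν) :* con (+ 3)) refl α β ν ⟩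
    (α ℤ.* α ℤ.+ β ℤ.* β ℤ.+ -[1+ 3 ] ℤ.* ν) ℤ.* + 3 ∎

  modulo-2 : ∀ g h → + 2 ∣ α ℤ.+ β × + 2 ∣ β ℤ.+ h × + 2 ∣ g ℤ.+ h →
    TraceCongruences α β (g ℤ.* + 3) (h ℤ.* + 3)
  modulo-2 g h (divides p α+β≡ , divides q β+h≡ , divides k g+h≡) =
      (p , trans α+β≡ (ℤ.*-comm p (+ 2)))
    , (q ℤ.+ h , (begin
        β ℤ.+ h ℤ.* + 3
          ≡⟨ solve 2 (λ β h → β :+ h :* con (+ 3) := (β :+ h) :+ con (+ 2) :* h) refl β h ⟩
        (β ℤ.+ h) ℤ.+ + 2 ℤ.* h          ≡⟨ cong (ℤ._+ + 2 ℤ.* h) β+h≡ ⟩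
        q ℤ.* + 2 ℤ.+ + 2 ℤ.* h
          ≡⟨ solve 2 (λ q h → q :* con (+ 2) :+ con (+ 2) :* h := con (+ 2) :* (q :+ h)) refl q h ⟩
        + 2 ℤ.* (q ℤ.+ h)                ∎))
    , (ℤ.- g , solve 1 (λ g → g :* con (+ 3) := con -[1+ 2 ] :* (:- g)) refl g)
    , (k ℤ.- h , (begin
        g ℤ.* + 3 ℤ.+ -[1+ 0 ] ℤ.* (h ℤ.* + 3)
          ≡⟨ solve 2 (λ g h → g :* con (+ 3) :+ con -[1+ 0 ] :* (h :* con (+ 3))
               := con (+ 3) :* (g :+ h) :- con (+ 6) :* h) refl g h ⟩
        + 3 ℤ.* (g ℤ.+ h) ℤ.- + 6 ℤ.* h  ≡⟨ cong (λ m → + 3 ℤ.* m ℤ.- + 6 ℤ.* h) g+h≡ ⟩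
        + 3 ℤ.* (k ℤ.* + 2) ℤ.- + 6 ℤ.* h
          ≡⟨ solve 2 (λ k h → con (+ 3) :* (k :* con (+ 2)) :- con (+ 6) :* h := con (+ 6) :* (k :- h)) refl k h ⟩
        + 6 ℤ.* (k ℤ.- h)                ∎))

  -- `γ` and `δ` are bound afresh, so that matching on the divisibility proofs can replace them by
  -- `g ℤ.* + 3` and `h ℤ.* + 3`.
  modulo-3 : ∀ {γ δ} → + 3 ∣ γ × + 3 ∣ δ → traceFormℤ α β γ δ ≡ + 12 ℤ.* ν → TraceCongruences α β γ δ
  modulo-3 (divides g refl , divides h refl) form≡12ν = modulo-2 g h (4∣sum-of-squares α β g h
    (divides (ν ℤ.+ (g ℤ.* g ℤ.+ h ℤ.* h))
      (ℤ.*-cancelˡ-≡ (+ 3) (sum-of-squares α β g h) ((ν ℤ.+ (g ℤ.* g ℤ.+ h ℤ.* h)) ℤ.* + 4) (begin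
    + 3 ℤ.* sum-of-squares α β g h
      ≡⟨ solve 4 (λ α β g h → con (+ 3) :* ((α :* α :+ β :* β) :+ (g :* g :+ h :* h))
           := con (+ 3) :* (α :* α :+ β :* β)
                :+ con -[1+ 0 ] :* (g :* con (+ 3) :* (g :* con (+ 3)) :+ h :* con (+ 3) :* (h :* con (+ 3)))
              :+ con (+ 12) :* (g :* g :+ h :* h)) refl α β g h ⟩
    traceFormℤ α β (g ℤ.* + 3) (h ℤ.* + 3) ℤ.+ + 12 ℤ.* (g ℤ.* g ℤ.+ h ℤ.* h)
      ≡⟨ cong (ℤ._+ + 12 ℤ.* (g ℤ.* g ℤ.+ h ℤ.* h)) form≡12ν ⟩
    + 12 ℤ.* ν ℤ.+ + 12 ℤ.* (g ℤ.* g ℤ.+ h ℤ.* h)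
      ≡⟨ solve 3 (λ ν g h → con (+ 12) :* ν :+ con (+ 12) :* (g :* g :+ h :* h)
           := con (+ 3) :* ((ν :+ (g :* g :+ h :* h)) :* con (+ 4))) refl ν g h ⟩
    + 3 ℤ.* ((ν ℤ.+ (g ℤ.* g ℤ.+ h ℤ.* h)) ℤ.* + 4) ∎))))

integralOn-e₁ : ∀ x → IntegralOn std x → Integer (nrd x) → IntegralOn e₁ x
integralOn-e₁ x A (ν , nrd≡ν) = memberships
  (trace-congruences (proj₁ (A 0F)) (proj₁ (A 1F)) (proj₁ (A 2F)) (proj₁ (A 3F)) ν (toℚ-injective (begin
    toℚ (traceFormℤ (proj₁ (A 0F)) (proj₁ (A 1F)) (proj₁ (A 2F)) (proj₁ (A 3F)))  ≡⟨ 12nrd≡traceForm x A ⟨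
    toℚ (+ 12) ℚ.* nrd x      ≡⟨ cong (toℚ (+ 12) ℚ.*_) nrd≡ν ⟩
    toℚ (+ 12) ℚ.* toℚ ν      ≡⟨ toℚ-* (+ 12) ν ⟨
    toℚ (+ 12 ℤ.* ν)          ∎)))
  where
  open ≡-Reasoning
  unscale : ∀ c m {n} p → c ℚ.* toℚ m ≡ 1ℚ → n ≡ m ℤ.* p → c ℚ.* toℚ n ≡ toℚ p
  unscale c m p c*m≡1 refl = begin
    c ℚ.* toℚ (m ℤ.* p)       ≡⟨ cong (c ℚ.*_) (toℚ-* m p) ⟩
    c ℚ.* (toℚ m ℚ.* toℚ p)   ≡⟨ ℚ.*-assoc c (toℚ m) (toℚ p) ⟨
    c ℚ.* toℚ m ℚ.* toℚ p     ≡⟨ cong (ℚ._* toℚ p) c*m≡1 ⟩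
    1ℚ ℚ.* toℚ p              ≡⟨ ℚ.*-identityˡ (toℚ p) ⟩
    toℚ p                     ∎
  α = proj₁ (A 0F)
  β = proj₁ (A 1F)
  γ = proj₁ (A 2F)
  δ = proj₁ (A 3F)
  memberships : TraceCongruences α β γ δ → IntegralOn e₁ x
  memberships ((p , α+β≡) , _) 0F = p , (begin
    trd (x *ᴮ e₁ 0F)                                      ≡⟨ trd-e₁₀ x ⟩
    ½ ℚ.* (trd (x *ᴮ std 0F) ℚ.+ trd (x *ᴮ std 1F))       ≡⟨ cong (½ ℚ.*_) (cong₂ ℚ._+_ (proj₂ (A 0F)) (proj₂ (A 1F))) ⟩
    ½ ℚ.* (toℚ α ℚ.+ toℚ β)                               ≡⟨ cong (½ ℚ.*_) (toℚ-+ α β) ⟨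
    ½ ℚ.* toℚ (α ℤ.+ β)                                   ≡⟨ unscale ½ (+ 2) p refl α+β≡ ⟩
    toℚ p                                                 ∎)
  memberships (_ , (q , β+δ≡) , _) 1F = q , (begin
    trd (x *ᴮ e₁ 1F)                                      ≡⟨ trd-e₁₁ x ⟩
    ½ ℚ.* (trd (x *ᴮ std 1F) ℚ.+ trd (x *ᴮ std 3F))       ≡⟨ cong (½ ℚ.*_) (cong₂ ℚ._+_ (proj₂ (A 1F)) (proj₂ (A 3F))) ⟩
    ½ ℚ.* (toℚ β ℚ.+ toℚ δ)                               ≡⟨ cong (½ ℚ.*_) (toℚ-+ β δ) ⟨
    ½ ℚ.* toℚ (β ℤ.+ δ)                                   ≡⟨ unscale ½ (+ 2) q refl β+δ≡ ⟩
    toℚ q                                                 ∎)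
  memberships (_ , _ , (r , γ≡) , _) 2F = r , (begin
    trd (x *ᴮ e₁ 2F)                                      ≡⟨ trd-e₁₂ x ⟩
    (-[1+ 0 ] / 3) ℚ.* trd (x *ᴮ std 2F)                  ≡⟨ cong ((-[1+ 0 ] / 3) ℚ.*_) (proj₂ (A 2F)) ⟩
    (-[1+ 0 ] / 3) ℚ.* toℚ γ                              ≡⟨ unscale (-[1+ 0 ] / 3) -[1+ 2 ] r refl γ≡ ⟩
    toℚ r                                                 ∎)
  memberships (_ , _ , _ , (s , γ-δ≡)) 3F = s , (begin
    trd (x *ᴮ e₁ 3F)                                      ≡⟨ trd-e₁₃ x ⟩
    (+ 1 / 6) ℚ.* (trd (x *ᴮ std 2F) ℚ.+ toℚ -[1+ 0 ] ℚ.* trd (x *ᴮ std 3F))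
      ≡⟨ cong ((+ 1 / 6) ℚ.*_) (cong₂ ℚ._+_ (proj₂ (A 2F)) (cong (toℚ -[1+ 0 ] ℚ.*_) (proj₂ (A 3F)))) ⟩
    (+ 1 / 6) ℚ.* (toℚ γ ℚ.+ toℚ -[1+ 0 ] ℚ.* toℚ δ)
      ≡⟨ cong ((+ 1 / 6) ℚ.*_) (trans (toℚ-+ γ (-[1+ 0 ] ℤ.* δ)) (cong (toℚ γ ℚ.+_) (toℚ-* -[1+ 0 ] δ))) ⟨
    (+ 1 / 6) ℚ.* toℚ (γ ℤ.+ -[1+ 0 ] ℤ.* δ)              ≡⟨ unscale (+ 1 / 6) (+ 6) s refl γ-δ≡ ⟩
    toℚ s                                                 ∎)

std∈𝒪⟨6,1⟩ : ∀ k → std k ∈ 𝒪⟨6,1⟩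
std∈𝒪⟨6,1⟩ k = proj₂ 𝒪⟨6,1⟩≐ (inSpan f₁ std (coefficients e₁ std) k)

𝒪⟨6,1⟩-maximal : IsMaximalOrder 𝒪⟨6,1⟩
𝒪⟨6,1⟩-maximal = isOrder₁ , λ O′ order O⊆O′ {x} x∈O′ →
  proj₂ 𝒪⟨6,1⟩≐ (proj₂ (Dual.span≐integralOn f₁ e₁ f₁e₁-dual) (integralOn-e₁ x
    (λ k → integer-trd order (x *ᴮ std k) (IsOrder.*-closed order x∈O′ (O⊆O′ (std∈𝒪⟨6,1⟩ k))))
    (integer-nrd order x x∈O′)))

open Symbolic {16} using (_+ᴾ_; _-ᴾ_; _·ᴾ_; prove-quat)
open Variables
open ℚ-Solver using (con)

-- Suborders of index 3

-1ℤ : ℤ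
-1ℤ = -[1+ 0 ]

module _ {P : Subset} (P-sub : IsSubmodule P) where

  multiple-closed : ∀ c x y → toℚ c · x ≡ y → P x → P y
  multiple-closed c x y c·x≡y x∈ = subst P c·x≡y (P-sub .·-closed c {x} x∈)

  difference-closed : ∀ x y → P x → P y → P (x -ᴮ y)
  difference-closed x y x∈ y∈ = subst P
    (prove-quat (env 0ℚ 0ℚ x y 0ᴮ) (𝕩 +ᴾ (con (toℚ -1ℤ) ·ᴾ 𝕪)) (𝕩 -ᴾ 𝕪) refl refl refl refl)
    (P-sub .+-closed {x} {toℚ -1ℤ · y} x∈ (P-sub .·-closed -1ℤ {y} y∈))

  congruent-left : ∀ x y r → P (x -ᴮ r) → P (y -ᴮ r) → P (x -ᴮ y)
  congruent-left x y r x≡r y≡r = subst P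
    (prove-quat (env 0ℚ 0ℚ x y r) ((𝕩 -ᴾ 𝕫) -ᴾ (𝕪 -ᴾ 𝕫)) (𝕩 -ᴾ 𝕪) refl refl refl refl)
    (difference-closed (x -ᴮ r) (y -ᴮ r) x≡r y≡r)

  congruent-right : ∀ x r s → P (x -ᴮ r) → P (x -ᴮ s) → P (s -ᴮ r)
  congruent-right x r s x≡r x≡s = subst P
    (prove-quat (env 0ℚ 0ℚ x r s) ((𝕩 -ᴾ 𝕪) -ᴾ (𝕩 -ᴾ 𝕫)) (𝕫 -ᴾ 𝕪) refl refl refl refl)
    (difference-closed (x -ᴮ r) (x -ᴮ s) x≡r x≡s)

  self-congruent : ∀ x → P (x -ᴮ x)
  self-congruent x = subst P
    (prove-quat (env 0ℚ 0ℚ x 0ᴮ 0ᴮ) (constᴾ 0ℚ) (𝕩 -ᴾ 𝕩) refl refl refl refl) (P-sub .0-closed)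

module Index {n} {L M : Subset} (L-sub : IsSubmodule L) (index : HasIndex n L M) where
  private
    r = proj₁ index
    r∈M = proj₁ (proj₂ index)
    classify = proj₂ (proj₂ index)

  collision : (x : Vector B₆ (suc n)) → (∀ k → x k ∈ M) → ∃[ i ] ∃[ j ] i Fin.< j × x i -ᴮ x j ∈ L
  collision x x∈M with Fin.pigeonhole (ℕ.n<1+n n) (λ k → proj₁ (classify (x k) (x∈M k)))
  ... | i , j , i<j , same = i , j , i<j ,
    congruent-left L-sub (x i) (x j) (r (class j))
      (subst (λ c → x i -ᴮ r c ∈ L) same (proj₁ (proj₂ (classify (x i) (x∈M i)))))
      (proj₁ (proj₂ (classify (x j) (x∈M j))))
    where class = λ k → proj₁ (classify (x k) (x∈M k))

  -- Otherwise two of the n representatives would fall into the same one of the m classes and be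
  -- congruent modulo L, against the uniqueness of classes.
  no-fewer-classes : ∀ {m} → m ℕ.< n → (g : Vector B₆ m) → ¬ (∀ x → x ∈ M → ∃[ k ] x -ᴮ g k ∈ L)
  no-fewer-classes m<n g cover with Fin.pigeonhole m<n (λ i → proj₁ (cover (r i) (r∈M i)))
  ... | i , j , i<j , same = Fin.<⇒≢ i<j (trans (sym (unique (self-congruent L-sub (r i)))) (unique rᵢ≡rⱼ))
    where
    unique = proj₂ (proj₂ (classify (r i) (r∈M i)))
    class = λ k → proj₁ (cover (r k) (r∈M k))
    rᵢ≡rⱼ = congruent-left L-sub (r i) (r j) (g (class j))
      (subst (λ c → r i -ᴮ g c ∈ L) same (proj₂ (cover (r i) (r∈M i)))) (proj₂ (cover (r j) (r∈M j)))

  -- An arbitrary predicate `L` carries no decision procedure, but x lies in L exactly when it has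
  -- the same representative as 0, and equality in `Fin n` is decidable.
  membership? : 0ᴮ ∈ M → ∀ x → x ∈ M → Dec (x ∈ L)
  membership? 0∈M x x∈M with classify 0ᴮ 0∈M | classify x x∈M
  ... | c , 0≡c , unique₀ | d , x≡d , unique with c Fin.≟ d
  ...   | yes refl = yes (subst L
            (prove-quat (env 0ℚ 0ℚ x 0ᴮ 0ᴮ) (𝕩 -ᴾ constᴾ 0ℚ) 𝕩 refl refl refl refl)
            (congruent-left L-sub x 0ᴮ (r c) x≡d 0≡c))
  ...   | no c≢d = no λ x∈L → c≢d (unique₀ (subst L
            (prove-quat (env 0ℚ 0ℚ x (r d) 0ᴮ) ((𝕩 -ᴾ 𝕪) -ᴾ 𝕩) (constᴾ 0ℚ -ᴾ 𝕪) refl refl refl refl)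
            (difference-closed L-sub (x -ᴮ r d) x x≡d x∈L)))

increasing-pairs : (Q : Fin 4 → Fin 4 → Set) →
  Q 0F 1F → Q 0F 2F → Q 0F 3F → Q 1F 2F → Q 1F 3F → Q 2F 3F → ∀ {i j} → i Fin.< j → Q i j
increasing-pairs Q a b c d e f {0F} {1F} _ = a
increasing-pairs Q a b c d e f {0F} {2F} _ = b
increasing-pairs Q a b c d e f {0F} {3F} _ = c
increasing-pairs Q a b c d e f {1F} {2F} _ = d
increasing-pairs Q a b c d e f {1F} {3F} _ = e
increasing-pairs Q a b c d e f {2F} {3F} _ = f
increasing-pairs Q a b c d e f {1F} {1F} (ℕ.s≤s ())
increasing-pairs Q a b c d e f {2F} {1F} (ℕ.s≤s ())
increasing-pairs Q a b c d e f {2F} {2F} (ℕ.s≤s (ℕ.s≤s ()))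
increasing-pairs Q a b c d e f {3F} {1F} (ℕ.s≤s ())
increasing-pairs Q a b c d e f {3F} {2F} (ℕ.s≤s (ℕ.s≤s ()))
increasing-pairs Q a b c d e f {3F} {3F} (ℕ.s≤s (ℕ.s≤s (ℕ.s≤s ())))

module Index₃ {L M : Subset} (L-sub : IsSubmodule L) (M-sub : IsSubmodule M) (index : HasIndex 3 L M) where
  open Index L-sub index

  private
    collision₄ : (x : Vector B₆ 4) → (∀ k → x k ∈ M) → {C : Set} →
      (x 0F -ᴮ x 1F ∈ L → C) → (x 0F -ᴮ x 2F ∈ L → C) → (x 0F -ᴮ x 3F ∈ L → C) →
      (x 1F -ᴮ x 2F ∈ L → C) → (x 1F -ᴮ x 3F ∈ L → C) → (x 2F -ᴮ x 3F ∈ L → C) → C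
    collision₄ x x∈M {C} a b c d e f = let i , j , i<j , xᵢ-xⱼ∈L = collision x x∈M in
      increasing-pairs (λ i j → x i -ᴮ x j ∈ L → C) a b c d e f {i} {j} i<j xᵢ-xⱼ∈L

  -- Doubling is injective on a quotient of order 3.
  halve : ∀ x → x ∈ M → toℚ (+ 2) · x ∈ L → x ∈ L
  halve x x∈M 2x∈L with membership? (M-sub .0-closed) x x∈M
  ... | yes x∈L = x∈L
  -- Otherwise L and x + L would already cover M.
  ... | no  x∉L = ⊥-elim (no-fewer-classes ℕ.≤-refl (0ᴮ ∷ x ∷ []) cover)
    where
    cover : ∀ w → w ∈ M → ∃[ k ] w -ᴮ (0ᴮ ∷ x ∷ []) k ∈ L
    -- Two of 0, x, w, w - x agree modulo L. The pairs with difference x up to sign contradict x ∉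
    -- L; the others put w in L or in x + L, the pair x and w - x by means of 2x ∈ L.
    cover w w∈M = collision₄ (0ᴮ ∷ x ∷ w ∷ (w -ᴮ x) ∷ [])
      (λ { 0F → M-sub .0-closed ; 1F → x∈M ; 2F → w∈M ; 3F → difference-closed M-sub w x w∈M x∈M })
      (λ d → ⊥-elim (x∉L (multiple-closed L-sub -1ℤ (0ᴮ -ᴮ x) x
        (prove-quat ρ (-𝟙 ·ᴾ (constᴾ 0ℚ -ᴾ 𝕩)) 𝕩 refl refl refl refl) d)))
      (λ d → 0F , multiple-closed L-sub -1ℤ (0ᴮ -ᴮ w) (w -ᴮ 0ᴮ)
        (prove-quat ρ (-𝟙 ·ᴾ (constᴾ 0ℚ -ᴾ 𝕪)) (𝕪 -ᴾ constᴾ 0ℚ) refl refl refl refl) d)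
      (λ d → 1F , multiple-closed L-sub -1ℤ (0ᴮ -ᴮ (w -ᴮ x)) (w -ᴮ x)
        (prove-quat ρ (-𝟙 ·ᴾ (constᴾ 0ℚ -ᴾ (𝕪 -ᴾ 𝕩))) (𝕪 -ᴾ 𝕩) refl refl refl refl) d)
      (λ d → 1F , multiple-closed L-sub -1ℤ (x -ᴮ w) (w -ᴮ x)
        (prove-quat ρ (-𝟙 ·ᴾ (𝕩 -ᴾ 𝕪)) (𝕪 -ᴾ 𝕩) refl refl refl refl) d)
      (λ d → 0F , subst L
        (prove-quat ρ ((con (toℚ (+ 2)) ·ᴾ 𝕩) -ᴾ (𝕩 -ᴾ (𝕪 -ᴾ 𝕩))) (𝕪 -ᴾ constᴾ 0ℚ) refl refl refl refl)
        (difference-closed L-sub (toℚ (+ 2) · x) (x -ᴮ (w -ᴮ x)) 2x∈L d))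
      (λ d → ⊥-elim (x∉L (multiple-closed L-sub (+ 1) (w -ᴮ (w -ᴮ x)) x
        (prove-quat ρ (con (toℚ (+ 1)) ·ᴾ (𝕪 -ᴾ (𝕪 -ᴾ 𝕩))) 𝕩 refl refl refl refl) d)))
      where
      ρ = env 0ℚ 0ℚ x w 0ᴮ
      -𝟙 = con (toℚ -1ℤ)

  -- Two of 0, x, 2x, 3x agree modulo L, so x, 2x or 3x lies in L; from 2x one passes to x by
  -- `halve`.
  thrice : ∀ x → x ∈ M → toℚ (+ 3) · x ∈ L
  thrice x x∈M = collision₄ (0ᴮ ∷ x ∷ 2x ∷ 3x ∷ [])
    (λ { 0F → M-sub .0-closed ; 1F → x∈M ; 2F → M-sub .·-closed (+ 2) {x} x∈M ; 3F → M-sub .·-closed (+ 3) {x} x∈M })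
    (multiple-closed L-sub -[1+ 2 ] (0ᴮ -ᴮ x) 3x
      (prove-quat ρ (con (toℚ -[1+ 2 ]) ·ᴾ (constᴾ 0ℚ -ᴾ 𝕩)) 3𝕩 refl refl refl refl))
    (λ d → from-2x (multiple-closed L-sub -1ℤ (0ᴮ -ᴮ 2x) 2x
      (prove-quat ρ (con (toℚ -1ℤ) ·ᴾ (constᴾ 0ℚ -ᴾ 2𝕩)) 2𝕩 refl refl refl refl) d))
    (multiple-closed L-sub -1ℤ (0ᴮ -ᴮ 3x) 3x
      (prove-quat ρ (con (toℚ -1ℤ) ·ᴾ (constᴾ 0ℚ -ᴾ 3𝕩)) 3𝕩 refl refl refl refl))
    (multiple-closed L-sub -[1+ 2 ] (x -ᴮ 2x) 3x
      (prove-quat ρ (con (toℚ -[1+ 2 ]) ·ᴾ (𝕩 -ᴾ 2𝕩)) 3𝕩 refl refl refl refl))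
    (λ d → from-2x (multiple-closed L-sub -1ℤ (x -ᴮ 3x) 2x
      (prove-quat ρ (con (toℚ -1ℤ) ·ᴾ (𝕩 -ᴾ 3𝕩)) 2𝕩 refl refl refl refl) d))
    (multiple-closed L-sub -[1+ 2 ] (2x -ᴮ 3x) 3x
      (prove-quat ρ (con (toℚ -[1+ 2 ]) ·ᴾ (2𝕩 -ᴾ 3𝕩)) 3𝕩 refl refl refl refl))
    where
    2x = toℚ (+ 2) · x
    3x = toℚ (+ 3) · x
    ρ = env 0ℚ 0ℚ x 0ᴮ 0ᴮ
    2𝕩 = con (toℚ (+ 2)) ·ᴾ 𝕩
    3𝕩 = con (toℚ (+ 3)) ·ᴾ 𝕩
    from-2x : 2x ∈ L → 3x ∈ L
    from-2x 2x∈L = L-sub .·-closed (+ 3) {x} (halve x x∈M 2x∈L)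

  -- Indexing by `Fin 3` lets identities in the sign be decided by `Fin.all?`.
  sign : Fin 3 → ℤ
  sign = + 0 ∷ + 1 ∷ -1ℤ ∷ []

  -- Two of 0, y, z, y + z agree modulo L, and up to sign their differences are y, z, y + z and y -
  -- z.
  dependence : ∀ y z → y ∈ M → z ∈ M → y ∈ L ⊎ ∃[ ε ] z +ᴮ toℚ (sign ε) · y ∈ L
  dependence y z y∈M z∈M = collision₄ (0ᴮ ∷ y ∷ z ∷ (y +ᴮ z) ∷ [])
    (λ { 0F → M-sub .0-closed ; 1F → y∈M ; 2F → z∈M ; 3F → M-sub .+-closed {y} {z} y∈M z∈M })
    (λ d → inj₁ (multiple-closed L-sub -1ℤ (0ᴮ -ᴮ y) y
      (prove-quat ρ (-𝟙 ·ᴾ (constᴾ 0ℚ -ᴾ 𝕩)) 𝕩 refl refl refl refl) d))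
    (λ d → inj₂ (0F , multiple-closed L-sub -1ℤ (0ᴮ -ᴮ z) (z +ᴮ toℚ (+ 0) · y)
      (prove-quat ρ (-𝟙 ·ᴾ (constᴾ 0ℚ -ᴾ 𝕪)) (𝕪 +ᴾ (con (toℚ (+ 0)) ·ᴾ 𝕩)) refl refl refl refl) d))
    (λ d → inj₂ (1F , multiple-closed L-sub -1ℤ (0ᴮ -ᴮ (y +ᴮ z)) (z +ᴮ toℚ (+ 1) · y)
      (prove-quat ρ (-𝟙 ·ᴾ (constᴾ 0ℚ -ᴾ (𝕩 +ᴾ 𝕪))) (𝕪 +ᴾ (con (toℚ (+ 1)) ·ᴾ 𝕩)) refl refl refl refl) d))
    (λ d → inj₂ (2F , multiple-closed L-sub -1ℤ (y -ᴮ z) (z +ᴮ toℚ -1ℤ · y)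
      (prove-quat ρ (-𝟙 ·ᴾ (𝕩 -ᴾ 𝕪)) (𝕪 +ᴾ (-𝟙 ·ᴾ 𝕩)) refl refl refl refl) d))
    (λ d → inj₂ (0F , multiple-closed L-sub -1ℤ (y -ᴮ (y +ᴮ z)) (z +ᴮ toℚ (+ 0) · y)
      (prove-quat ρ (-𝟙 ·ᴾ (𝕩 -ᴾ (𝕩 +ᴾ 𝕪))) (𝕪 +ᴾ (con (toℚ (+ 0)) ·ᴾ 𝕩)) refl refl refl refl) d))
    (λ d → inj₁ (multiple-closed L-sub -1ℤ (z -ᴮ (y +ᴮ z)) y
      (prove-quat ρ (-𝟙 ·ᴾ (𝕪 -ᴾ (𝕩 +ᴾ 𝕪))) 𝕩 refl refl refl refl) d))
    where
    ρ = env 0ℚ 0ℚ y z 0ᴮ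
    -𝟙 = con (toℚ -1ℤ)

-- The index of `𝒪⟨6,3⟩` and its stability under `ζ₃`

i j ij : B₆
i = std 1F
j = std 2F
ij = std 3F

toℚ-denominator : ∀ z → ↧ (toℚ z) ≡ + 1
toℚ-denominator (+ n)    = cong ↧_ (ℚ.normalize-coprime (Coprime.sym (Coprime.1-coprimeTo n)))
toℚ-denominator -[1+ n ] = cong (λ q → ↧ (ℚ.- q)) (ℚ.normalize-coprime (Coprime.sym (Coprime.1-coprimeTo (suc n))))

representative : Fin 3 → B₆
representative k = toℚ (+ toℕ k) · i

𝒪⟨6,3⟩⊆𝒪⟨6,1⟩ : 𝒪⟨6,3⟩ ⊆ 𝒪⟨6,1⟩
𝒪⟨6,3⟩⊆𝒪⟨6,1⟩ x∈ = proj₂ 𝒪⟨6,1⟩≐ (span-⊆ (span-submodule f₁) (inSpan f₁ f₂ (coefficients e₁ f₂)) x∈)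

𝒪⟨6,1⟩-submodule : IsSubmodule 𝒪⟨6,1⟩
𝒪⟨6,1⟩-submodule = span-submodule generators⟨6,1⟩

-- The trace against `e₂ 0F` is integral on `𝒪⟨6,3⟩` and equals -m/3 at mi. Integrality is tested as
-- having denominator 1, which leaves a decidable check over nine pairs.
representative-injective : ∀ k l → representative l -ᴮ representative k ∈ 𝒪⟨6,3⟩ → k ≡ l
representative-injective k l l-k∈ = separated k l (trans (cong ↧_ trd≡z) (toℚ-denominator z))
  where
  integral = proj₁ (Dual.span≐integralOn f₂ e₂ f₂e₂-dual) l-k∈ 0F
  z = proj₁ integral
  trd≡z = proj₂ integral
  separated : ∀ k l → ↧ trd ((representative l -ᴮ representative k) *ᴮ e₂ 0F) ≡ + 1 → k ≡ l
  separated = from-yes (Fin.all? λ (k : Fin 3) → Fin.all? λ (l : Fin 3) →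
    (↧ trd ((representative l -ᴮ representative k) *ᴮ e₂ 0F) ℤ.≟ + 1) →-dec (k Fin.≟ l))

𝒪⟨6,1⟩⊆ℤi+𝒪⟨6,3⟩ : 𝒪⟨6,1⟩ ⊆ span (i ∷ f₂)
𝒪⟨6,1⟩⊆ℤi+𝒪⟨6,3⟩ x∈ = span-⊆ (span-submodule (i ∷ f₂)) (inSpan (i ∷ f₂) f₁
  ( (+ 0 ∷ + 1 ∷ + 0 ∷ + 0 ∷ + 0 ∷ [])
  ∷ (-[1+ 0 ] ∷ -[1+ 0 ] ∷ + 0 ∷ + 0 ∷ + 0 ∷ [])
  ∷ (+ 0 ∷ -[1+ 0 ] ∷ + 0 ∷ + 1 ∷ + 0 ∷ [])
  ∷ (+ 0 ∷ -[1+ 1 ] ∷ + 0 ∷ + 0 ∷ + 1 ∷ [])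
  ∷ [])) (proj₁ 𝒪⟨6,1⟩≐ x∈)

-- The quotient is generated by i, and 3i lies in `𝒪⟨6,3⟩`, so the coefficient of i modulo 3 selects
-- the coset.
index-3 : HasIndex 3 𝒪⟨6,3⟩ 𝒪⟨6,1⟩
index-3 = representative , (λ k → 𝒪⟨6,1⟩-submodule .·-closed (+ toℕ k) {i} (std∈𝒪⟨6,1⟩ 1F)) , λ x x∈ →
  let k , x-k∈ = reduce x (𝒪⟨6,1⟩⊆ℤi+𝒪⟨6,3⟩ x∈) in
  k , x-k∈ , λ {l} x-l∈ → representative-injective k l
    (congruent-right (span-submodule f₂) x (representative k) (representative l) x-k∈ x-l∈)
  where
  reduce : ∀ x → x ∈ span (i ∷ f₂) → ∃[ k ] x -ᴮ representative k ∈ 𝒪⟨6,3⟩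
  reduce _ (c , refl) with residue 3 (c 0F)
  ... | k , q , c₀≡k+3q = k , subst 𝒪⟨6,3⟩ difference≡
      (span-submodule f₂ .+-closed {toℚ (q ℤ.* + 3) · i} {y}
        (subst 𝒪⟨6,3⟩ (sym 3q·i≡) (span-submodule f₂ .·-closed q {toℚ (+ 3) · i} 3i∈)) (c ∘ suc , refl))
    where
    open ≡-Reasoning
    y = combination (c ∘ suc) f₂
    3i∈ : toℚ (+ 3) · i ∈ 𝒪⟨6,3⟩
    3i∈ = (-[1+ 0 ] ∷ -[1+ 0 ] ∷ + 0 ∷ + 0 ∷ []) , refl
    3q·i≡ : toℚ (q ℤ.* + 3) · i ≡ toℚ q · (toℚ (+ 3) · i)
    3q·i≡ = begin
      toℚ (q ℤ.* + 3) · i          ≡⟨ cong (_· i) (toℚ-* q (+ 3)) ⟩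
      (toℚ q ℚ.* toℚ (+ 3)) · i    ≡⟨ prove-quat (env (toℚ q) (toℚ (+ 3)) i 0ᴮ 0ᴮ)
                                        ((𝕡 ℚ-Solver.:* 𝕢) ·ᴾ 𝕩) (𝕡 ·ᴾ (𝕢 ·ᴾ 𝕩)) refl refl refl refl ⟩
      toℚ q · (toℚ (+ 3) · i)      ∎
    difference≡ : toℚ (q ℤ.* + 3) · i +ᴮ y ≡ (toℚ (c 0F) · i +ᴮ y) -ᴮ representative k
    difference≡ = begin
      toℚ (q ℤ.* + 3) · i +ᴮ y
        ≡⟨ prove-quat (env (toℚ (+ toℕ k)) (toℚ (q ℤ.* + 3)) i y 0ᴮ)
             ((𝕢 ·ᴾ 𝕩) +ᴾ 𝕪) ((((𝕡 ℚ-Solver.:+ 𝕢) ·ᴾ 𝕩) +ᴾ 𝕪) -ᴾ (𝕡 ·ᴾ 𝕩)) refl refl refl refl ⟩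
      ((toℚ (+ toℕ k) ℚ.+ toℚ (q ℤ.* + 3)) · i +ᴮ y) -ᴮ representative k
        ≡⟨ cong (λ p → (p · i +ᴮ y) -ᴮ representative k)
             (trans (cong toℚ c₀≡k+3q) (toℚ-+ (+ toℕ k) (q ℤ.* + 3))) ⟨
      (toℚ (c 0F) · i +ᴮ y) -ᴮ representative k ∎

-- ζ₃ has reduced norm 1 and lies in `𝒪⟨6,3⟩` together with its conjugate, which is its inverse;
-- conjugation by a unit of an order preserves the order.
stable : StableUnderConjugation ζ₃ 𝒪⟨6,3⟩
stable = conj ζ₃ , refl , refl , λ x → mk⇔
  (λ x∈ → *-closed (*-closed ζ₃∈ x∈) ζ̄₃∈)
  (λ y∈ → subst 𝒪⟨6,3⟩ (unconjugate x) (*-closed (*-closed ζ̄₃∈ y∈) ζ₃∈))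
  where
  open IsOrder isOrder₂ using (*-closed)
  ζ₃∈ : ζ₃ ∈ 𝒪⟨6,3⟩
  ζ₃∈ = (-[1+ 0 ] ∷ + 0 ∷ -[1+ 0 ] ∷ + 0 ∷ []) , refl
  ζ̄₃∈ : conj ζ₃ ∈ 𝒪⟨6,3⟩
  ζ̄₃∈ = (+ 0 ∷ + 0 ∷ + 1 ∷ + 0 ∷ []) , refl
  unconjugate : ∀ x → (conj ζ₃ *ᴮ ((ζ₃ *ᴮ x) *ᴮ conj ζ₃)) *ᴮ ζ₃ ≡ x
  unconjugate = linear-ext
    (∘-linear (*ᴮʳ-linear ζ₃) (∘-linear (*ᴮˡ-linear (conj ζ₃))
      (∘-linear (*ᴮʳ-linear (conj ζ₃)) (*ᴮˡ-linear ζ₃))))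
    id-linear (from-yes (Fin.all? λ k → ((conj ζ₃ *ᴮ ((ζ₃ *ᴮ std k) *ᴮ conj ζ₃)) *ᴮ ζ₃) ≟ᴮ std k))

-- Uniqueness of the suborder of index 3

module IndexThreeSuborder {L : Subset} (order : IsOrder L) (L⊆𝒪 : L ⊆ 𝒪⟨6,1⟩) (index : HasIndex 3 L 𝒪⟨6,1⟩) where
  open IsOrder order using (one; *-closed)
  private L-sub = order-submodule order
  open Index L-sub index
  open Index₃ L-sub 𝒪⟨6,1⟩-submodule index

  3i∈L : toℚ (+ 3) · i ∈ L
  3i∈L = thrice i (std∈𝒪⟨6,1⟩ 1F)

  -- With u = i + εj and w = ij + δj in L,
  -- (1 + δ²) j = δw - uw - 3εi + 3εδ, and 1 + δ² is 1 or -1 modulo 3.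
  j∈L : j ∈ L
  j∈L = case (dependence j i (std∈𝒪⟨6,1⟩ 2F) (std∈𝒪⟨6,1⟩ 1F))
             (dependence j ij (std∈𝒪⟨6,1⟩ 2F) (std∈𝒪⟨6,1⟩ 3F))
    where
    u w : Fin 3 → B₆
    u ε = i +ᴮ toℚ (sign ε) · j
    w δ = ij +ᴮ toℚ (sign δ) · j
    generators : Fin 3 → Fin 3 → Vector B₆ 5
    generators ε δ = w δ ∷ (u ε *ᴮ w δ) ∷ toℚ (+ 3) · i ∷ 1ᴮ ∷ toℚ (+ 3) · j ∷ []
    weights : Fin 3 → Fin 3 → Vector ℤ 5
    -- `m` is -1 for δ = 0 and 1 for δ = ±1. In the latter case the identity above yields 2j, and j
    -- = 3j - 2j accounts for the weight δ² on 3j.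
    weights ε δ = let e = sign ε; d = sign δ; m = + 2 ℤ.* (d ℤ.* d) ℤ.- + 1 in
      ℤ.- d ∷ m ∷ e ℤ.* m ∷ -[1+ 2 ] ℤ.* (e ℤ.* d) ∷ d ℤ.* d ∷ []
    solution : ∀ ε δ → j ≡ combination (weights ε δ) (generators ε δ)
    solution = from-yes (Fin.all? λ (ε : Fin 3) → Fin.all? λ (δ : Fin 3) →
      j ≟ᴮ combination (weights ε δ) (generators ε δ))
    case : j ∈ L ⊎ ∃[ ε ] u ε ∈ L → j ∈ L ⊎ ∃[ δ ] w δ ∈ L → j ∈ L
    case (inj₁ j∈) _ = j∈
    case (inj₂ _) (inj₁ j∈) = j∈
    case (inj₂ (ε , u∈)) (inj₂ (δ , w∈)) = span-⊆ {P = L} L-sub {e = generators ε δ}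
      (λ { 0F → w∈ ; 1F → *-closed u∈ w∈ ; 2F → 3i∈L ; 3F → one ; 4F → thrice j (std∈𝒪⟨6,1⟩ 2F) })
      {j} (weights ε δ , solution ε δ)

  -- (i + ε ij) j = ij + 3ε i.
  ij∈L : ij ∈ L
  ij∈L = case (dependence ij i (std∈𝒪⟨6,1⟩ 3F) (std∈𝒪⟨6,1⟩ 1F))
    where
    u : Fin 3 → B₆
    u ε = i +ᴮ toℚ (sign ε) · ij
    generators : Fin 3 → Vector B₆ 2
    generators ε = (u ε *ᴮ j) ∷ toℚ (+ 3) · i ∷ []
    weights : Fin 3 → Vector ℤ 2
    weights ε = + 1 ∷ ℤ.- sign ε ∷ []
    solution : ∀ ε → ij ≡ combination (weights ε) (generators ε)
    solution = from-yes (Fin.all? λ (ε : Fin 3) → ij ≟ᴮ combination (weights ε) (generators ε))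
    case : ij ∈ L ⊎ ∃[ ε ] u ε ∈ L → ij ∈ L
    case (inj₁ ij∈) = ij∈
    case (inj₂ (ε , u∈)) = span-⊆ {P = L} L-sub {e = generators ε}
      (λ { 0F → *-closed u∈ j∈L ; 1F → 3i∈L }) {ij} (weights ε , solution ε)

  𝒪⟨6,3⟩⊆L : 𝒪⟨6,3⟩ ⊆ L
  𝒪⟨6,3⟩⊆L = span-⊆ L-sub λ k → span-⊆ L-sub generators∈L (f₂∈ k)
    where
    generators : Vector B₆ 5
    -- Twice `f₂ 2F` is -(1 + 3i + j + ij), so adjoining its triple recovers the half-integral
    -- vector `f₂ 2F` itself.
    generators = 1ᴮ ∷ toℚ (+ 3) · i ∷ j ∷ ij ∷ toℚ (+ 3) · f₂ 2F ∷ []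
    generators∈L : ∀ k → generators k ∈ L
    generators∈L 0F = one
    generators∈L 1F = 3i∈L
    generators∈L 2F = j∈L
    generators∈L 3F = ij∈L
    generators∈L 4F = thrice (f₂ 2F) (𝒪⟨6,3⟩⊆𝒪⟨6,1⟩ (basis∈span f₂ 2F))
    f₂∈ : ∀ k → f₂ k ∈ span generators
    f₂∈ = inSpan generators f₂
      ( (+ 1 ∷ + 0 ∷ + 0 ∷ + 0 ∷ + 0 ∷ [])
      ∷ (-[1+ 0 ] ∷ -[1+ 0 ] ∷ + 0 ∷ + 0 ∷ + 0 ∷ [])
      ∷ (+ 1 ∷ + 1 ∷ + 1 ∷ + 1 ∷ + 1 ∷ [])
      ∷ (-[1+ 0 ] ∷ -[1+ 0 ] ∷ + 0 ∷ -[1+ 0 ] ∷ + 0 ∷ [])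
      ∷ [])

  -- With i, L would contain ℤi + `𝒪⟨6,3⟩`, hence all of `𝒪⟨6,1⟩`, and a single coset would do.
  i∉L : ¬ i ∈ L
  i∉L i∈L = no-fewer-classes (ℕ.s≤s (ℕ.s≤s ℕ.z≤n)) (0ᴮ ∷ []) λ x x∈ → 0F ,
    difference-closed L-sub x 0ᴮ (span-⊆ L-sub {e = i ∷ f₂} (λ { zero → i∈L ; (suc k) → 𝒪⟨6,3⟩⊆L (basis∈span f₂ k) })
      (𝒪⟨6,1⟩⊆ℤi+𝒪⟨6,3⟩ x∈)) (L-sub .0-closed)

  -- An element x of L is congruent to 0, i or 2i modulo `𝒪⟨6,3⟩`, which lies in L, so that multiple
  -- of i is in L too. This excludes i, and also 2i by `halve`.
  L⊆𝒪⟨6,3⟩ : L ⊆ 𝒪⟨6,3⟩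
  L⊆𝒪⟨6,3⟩ {x} x∈L = case (proj₁ class) (proj₁ (proj₂ class))
    where
    class = proj₂ (proj₂ index-3) x (L⊆𝒪 x∈L)
    k·i∈L : ∀ k → x -ᴮ representative k ∈ 𝒪⟨6,3⟩ → representative k ∈ L
    k·i∈L k x-k∈ = subst L (prove-quat (env 0ℚ 0ℚ x (representative k) 0ᴮ) (𝕩 -ᴾ (𝕩 -ᴾ 𝕪)) 𝕪 refl refl refl refl)
      (difference-closed L-sub x (x -ᴮ representative k) x∈L (𝒪⟨6,3⟩⊆L x-k∈))
    case : ∀ k → x -ᴮ representative k ∈ 𝒪⟨6,3⟩ → x ∈ 𝒪⟨6,3⟩
    case 0F x-0∈ = subst 𝒪⟨6,3⟩ (prove-quat (env 0ℚ 0ℚ x i 0ᴮ) (𝕩 -ᴾ (con (toℚ (+ 0)) ·ᴾ 𝕪)) 𝕩 refl refl refl refl) x-0∈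
    case 1F x-i∈ = ⊥-elim (i∉L (k·i∈L 1F x-i∈))
    case 2F x-2i∈ = ⊥-elim (i∉L (halve i (std∈𝒪⟨6,1⟩ 1F) (k·i∈L 2F x-2i∈)))

theorem3p2 : IsMaximalOrder 𝒪⟨6,1⟩ ×
    (Σ[ 𝒪⟨6,3⟩ ∈ Subset ]
    (IsOrder 𝒪⟨6,3⟩ × 𝒪⟨6,3⟩ ⊆ 𝒪⟨6,1⟩ × HasIndex 3 𝒪⟨6,3⟩ 𝒪⟨6,1⟩
    × HasReducedDiscriminant 𝒪⟨6,3⟩ 18)
    × ((L : Subset) → IsOrder L → L ⊆ 𝒪⟨6,1⟩ → HasIndex 3 L 𝒪⟨6,1⟩
    → HasReducedDiscriminant L 18 → L ≐ 𝒪⟨6,3⟩)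
    × StableUnderConjugation ζ₃ 𝒪⟨6,3⟩
    × (IsOrder (evenTrace 𝒪⟨6,1⟩) × HasReducedDiscriminant (evenTrace 𝒪⟨6,1⟩) 12)
    × (IsOrder (evenTrace 𝒪⟨6,3⟩) × HasReducedDiscriminant (evenTrace 𝒪⟨6,3⟩) 36)
    × CorrespondsTo 𝒪⟨6,1⟩ 6 G₁
    × CorrespondsTo 𝒪⟨6,3⟩ 18 G₂
    × CorrespondsTo (evenTrace 𝒪⟨6,1⟩) 12 G₃
    × CorrespondsTo (evenTrace 𝒪⟨6,3⟩) 36 G₄)
theorem3p2 = 𝒪⟨6,1⟩-maximal , 𝒪⟨6,3⟩
  , (isOrder₂ , 𝒪⟨6,3⟩⊆𝒪⟨6,1⟩ , index-3 , proj₁ correspondsTo₂)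
  , (λ L order L⊆ index _ →
      IndexThreeSuborder.L⊆𝒪⟨6,3⟩ order L⊆ index , IndexThreeSuborder.𝒪⟨6,3⟩⊆L order L⊆ index)
  , stable
  , (isOrder₃ , proj₁ correspondsTo₃)
  , (isOrder₄ , proj₁ correspondsTo₄)
  , correspondsTo₁ , correspondsTo₂ , correspondsTo₃ , correspondsTo₄
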